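{- Let $k\geq3$ be odd and let $d$ be an integer with $d\geq\frac{3^k}{2k}+1$. Then $C_{d,k}\geq 2k\left(\lfloor\frac{d}{2}\rfloor\right)^{k}$.
   Context: A Cayley digraph $Cay(\Gamma,X)$ of a group $\Gamma$ with respect to a generating set $X$ not containing the identity has vertex set $\Gamma$ and an arc from $u$ to $v$ iff $ux=v$ for some $x\in X$; its degree is $|X|$. $C_{d,k}$ denotes the largest number of vertices of a Cayley digraph of degree $d$ and diameter $k$ (diameter = maximum directed distance). -}

module Defs where

open import Data.Nat using (ℕ; suc; _+_; _*_; _≤_; _<_)
open import Data.Fin using (Fin)
open import Data.List using (List; length; foldl)
open import Data.List.Relation.Unary.All using (All)
open import Data.List.Relation.Unary.Unique.Propositional using (Unique)
open import Data.List.Membership.Propositional using (_∈_)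
open import Data.Product using (Σ; ∃; _×_; _,_)
open import Relation.Binary.PropositionalEquality using (_≡_)
open import Relation.Nullary using (¬_)
open import Algebra.Structures using (IsGroup)

record FinGroup (n : ℕ) : Set where
  field
    _∙_ : Fin n → Fin n → Fin n
    ε   : Fin n
    _⁻¹ : Fin n → Fin n
    isGroup : IsGroup _≡_ _∙_ ε _⁻¹

Odd : ℕ → Set
Odd k = ∃ λ m → k ≡ 2 * m + 1

module _ {n : ℕ} (G : FinGroup n) (X : List (Fin n)) where
  open FinGroup G

  walkEnd : Fin n → List (Fin n) → Fin n
  walkEnd u w = foldl _∙_ u w

  -- There is a directed walk of length exactly m from u to v in Cay(G,X)
  -- (arcs u → u·x for x ∈ X).
  WalkOfLength : ℕ → Fin n → Fin n → Set
  WalkOfLength m u v =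
    Σ (List (Fin n)) λ w → All (_∈ X) w × length w ≡ m × walkEnd u w ≡ v

  DistLe : ℕ → Fin n → Fin n → Set
  DistLe m u v = ∃ λ j → j ≤ m × WalkOfLength j u v

  HasDiameter : ℕ → Set
  HasDiameter k =
    (∀ u v → DistLe k u v) ×
    (∃ λ u → ∃ λ v → ∀ j → j < k → ¬ WalkOfLength j u v)

  IsConnectionSetOfDegree : ℕ → Set
  IsConnectionSetOfDegree d = Unique X × ¬ (ε ∈ X) × length X ≡ d

CdkAtLeast : ℕ → ℕ → ℕ → Set
CdkAtLeast d k N =
  ∃ λ n → Σ (FinGroup n) λ G → Σ (List (Fin n)) λ X →
    IsConnectionSetOfDegree G X d × HasDiameter G X k × N ≤ n

{-# OPTIONS --safe #-}

-- With m = ⌊d/2⌋, the group is (ℤ/m)^(ℤ/k) ⋊ D, where D is the dihedral group of order 2k acting on the k "cells" ℤ/k: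
-- (q , up) sends c to q + c and (q , down) sends c to q - 1 - c.  There are two families of m generators,
-- r_h = (h e₀ , (2 , up)) and s_h = (h (e₀ + e₁) , (0 , down)).  Reading a product from left to right is running a machine
-- whose state is an element of D and which adds freely chosen multiples of fixed vectors to the k cells:
--     at (q , up)    r writes cell q      and moves to (q + 2 , up),    s writes q and q + 1 jointly      and turns to (q , down);
--     at (q , down)  r writes cell q - 1  and moves to (q - 2 , down),  s writes q - 1 and q - 2 jointly  and turns to (q , up).
-- The block rssr moves by four cells and fills all four of them.  For k odd, each of the 2k states is the end of a word of
-- length k whose k vectors span ℤ^k (hence (ℤ/m)^k); these words, grouped by shape, are
--     k = 2p + 4i + 1 :  r^p (rssr)^i r^(p+1)          to (2p + 1 , up),
--     k = 2b + 4e + 1 :  (rssr)^e r^b s r^b            to (4e , down),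
--     k = 2a + 4i + 3 :  r^a s r^a (rssr)^i r r        to (2a - 1 , down),
--     k = 2c + 4i + 3 :  s r^c (rssr)^i r r^(c+1)      to (4i + 2 , down),
-- and the same words with the last r replaced by s.  So every element is a product of k generators.  If d is odd, an arbitrary
-- further generator is added.  The diameter is not smaller than k because (d - 1)(1 + d + ⋯ + d^(k-1)) < d^k ≤ (3m)^k,
-- which is at most (d - 1) 2k m^k by the hypothesis on d.

module Submission where

open import Defs
open import Algebra.Bundles using (Group)
open import Algebra.Structures using (IsGroup)
open import Data.Fin using (Fin; zero; suc; toℕ; fromℕ<; combine; remQuot; funToFin; finToFun)
import Data.Fin.Properties as Fin
open import Data.Integer using (ℤ; +_; _+_; _*_; -_; _-_; _⊖_; ∣_∣; _%ℕ_; _/ℕ_; 0ℤ; 1ℤ)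
open import Data.Integer.DivMod using (n%ℕd<d; a≡a%ℕn+[a/ℕn]*n)
import Data.Integer.Properties as ℤ
open import Data.Integer.Tactic.RingSolver using (solve-∀)
open import Data.List using (List; []; _∷_; _++_; length; replicate; map; allFin; concatMap; lookup)
import Data.List.Membership.DecPropositional as DecMembership
open import Data.List.Membership.Propositional using (_∈_; _∉_; lose)
open import Data.List.Membership.Propositional.Properties using (∈-map⁺; ∈-map⁻; ∈-++⁺ˡ; ∈-++⁺ʳ; ∈-++⁻; ∈-allFin; ∈-concatMap⁺)
import Data.List.Properties as List
open import Data.List.Relation.Unary.All using (All; []; _∷_)
open import Data.List.Relation.Unary.All.Properties using (¬Any⇒All¬)
open import Data.List.Relation.Unary.Any as Any using (here; there)
open import Data.List.Relation.Unary.Any.Properties using (lookup-index)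
open import Data.List.Relation.Unary.Unique.Propositional using (Unique; _∷_)
import Data.List.Relation.Unary.Unique.Propositional.Properties as Unique
open import Data.Nat as ℕ using (ℕ; zero; suc; s≤s; z≤n)
import Data.Nat.Divisibility as ℕ
import Data.Nat.DivMod as ℕ
import Data.Nat.Properties as ℕ
import Data.Nat.Tactic.RingSolver as ℕ-Solver
open import Data.Product using (∃; _×_; _,_; proj₁; proj₂)
open import Data.Sum using (_⊎_; inj₁; inj₂; [_,_]′)
open import Data.Vec using (Vec; []; _∷_)
open import Function using (_∋_; _∘_)
open import Level using (0ℓ)
open import Relation.Binary.PropositionalEquality using (_≡_; _≢_; _≗_; refl; sym; trans; cong; cong₂; subst; isEquivalence; module ≡-Reasoning)
open import Relation.Nullary using (¬_; contradiction; Dec; yes; no; ¬?)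
open import Relation.Nullary.Decidable using (decidable-stable)

-- Congruences of integers

infix 4 _≡_⟨mod_⟩

record _≡_⟨mod_⟩ (a b : ℤ) (n : ℕ) : Set where
  constructor by
  field
    quotient : ℤ
    equality : a ≡ b + quotient * + n

module Congruence {n : ℕ} where

  ≡⇒mod : ∀ {a b} → a ≡ b → a ≡ b ⟨mod n ⟩
  ≡⇒mod {a} refl = by 0ℤ (lemma a (+ n))
    where
    lemma : ∀ a n → a ≡ a + 0ℤ * n
    lemma = solve-∀

  mod-sym : ∀ {a b} → a ≡ b ⟨mod n ⟩ → b ≡ a ⟨mod n ⟩
  mod-sym {b = b} (by t refl) = by (- t) (lemma b t (+ n))
    where
    lemma : ∀ b t n → b ≡ b + t * n + (- t) * n
    lemma = solve-∀

  mod-trans : ∀ {a b c} → a ≡ b ⟨mod n ⟩ → b ≡ c ⟨mod n ⟩ → a ≡ c ⟨mod n ⟩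
  mod-trans {c = c} (by t refl) (by u refl) = by (u + t) (lemma c t u (+ n))
    where
    lemma : ∀ c t u n → c + u * n + t * n ≡ c + (u + t) * n
    lemma = solve-∀

  mod-+ : ∀ {a b c d} → a ≡ b ⟨mod n ⟩ → c ≡ d ⟨mod n ⟩ → a + c ≡ b + d ⟨mod n ⟩
  mod-+ {b = b} {d = d} (by t refl) (by u refl) = by (t + u) (lemma b d t u (+ n))
    where
    lemma : ∀ b d t u n → b + t * n + (d + u * n) ≡ b + d + (t + u) * n
    lemma = solve-∀

  mod-neg : ∀ {a b} → a ≡ b ⟨mod n ⟩ → - a ≡ - b ⟨mod n ⟩
  mod-neg {b = b} (by t refl) = by (- t) (lemma b t (+ n))
    where
    lemma : ∀ b t n → - (b + t * n) ≡ - b + (- t) * n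
    lemma = solve-∀

  mod-- : ∀ {a b c d} → a ≡ b ⟨mod n ⟩ → c ≡ d ⟨mod n ⟩ → a - c ≡ b - d ⟨mod n ⟩
  mod-- p q = mod-+ p (mod-neg q)

  mod-*ʳ : ∀ {a b} c → a ≡ b ⟨mod n ⟩ → a * c ≡ b * c ⟨mod n ⟩
  mod-*ʳ {b = b} c (by t refl) = by (t * c) (lemma b c t (+ n))
    where
    lemma : ∀ b c t n → (b + t * n) * c ≡ b * c + t * c * n
    lemma = solve-∀

open Congruence public

-- The difference is a multiple of n smaller than n, hence zero; truncated subtraction wants the
-- larger number first, whence `wlog`.
+[<n]-injective : ∀ {n i j} → i ℕ.< n → j ℕ.< n → + i ≡ + j ⟨mod n ⟩ → i ≡ j
+[<n]-injective {n} i<n j<n eq = [ wlog j<n (mod-sym eq) , (λ j≤i → sym (wlog i<n eq j≤i)) ]′ (ℕ.≤-total _ _)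
  where
  n∣m<n⇒m≡0 : ∀ {m} → n ℕ.∣ m → m ℕ.< n → m ≡ 0
  n∣m<n⇒m≡0 {zero}  _   _   = refl
  n∣m<n⇒m≡0 {suc m} n∣m m<n = contradiction n∣m (ℕ.>⇒∤ m<n)
  cancel : ∀ a b → b + a - b ≡ a
  cancel = solve-∀
  wlog : ∀ {i j} → i ℕ.< n → + i ≡ + j ⟨mod n ⟩ → j ℕ.≤ i → j ≡ i
  wlog {i} {j} i<n (by t eq) j≤i = ℕ.≤-antisym j≤i (ℕ.m∸n≡0⇒m≤n
    (n∣m<n⇒m≡0 (ℕ.divides ∣ t ∣ difference) (ℕ.≤-<-trans (ℕ.m∸n≤m i j) i<n)))
    where
    open ≡-Reasoning
    difference : i ℕ.∸ j ≡ ∣ t ∣ ℕ.* n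
    difference = begin
      i ℕ.∸ j                 ≡⟨ cong ∣_∣ (ℤ.⊖-≥ j≤i) ⟨
      ∣ i ⊖ j ∣               ≡⟨ cong ∣_∣ (ℤ.[+m]-[+n]≡m⊖n i j) ⟨
      ∣ + i - + j ∣           ≡⟨ cong (λ a → ∣ a - + j ∣) eq ⟩
      ∣ + j + t * + n - + j ∣ ≡⟨ cong ∣_∣ (cancel (t * + n) (+ j)) ⟩
      ∣ t * + n ∣             ≡⟨ ℤ.abs-* t (+ n) ⟩
      ∣ t ∣ ℕ.* n             ∎

module Residue (n : ℕ) .{{_ : ℕ.NonZero n}} where

  %-mod : ∀ a → a ≡ + (a %ℕ n) ⟨mod n ⟩
  %-mod a = by (a /ℕ n) (a≡a%ℕn+[a/ℕn]*n a n)

  residue : ℤ → Fin n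
  residue a = fromℕ< (n%ℕd<d a n)

  rep : Fin n → ℤ
  rep i = + toℕ i

  rep-residue : ∀ a → rep (residue a) ≡ a ⟨mod n ⟩
  rep-residue a = mod-trans (≡⇒mod (cong +_ (Fin.toℕ-fromℕ< (n%ℕd<d a n)))) (mod-sym (%-mod a))

  rep-injective : ∀ {i j} → rep i ≡ rep j ⟨mod n ⟩ → i ≡ j
  rep-injective {i} {j} eq = Fin.toℕ-injective (+[<n]-injective (Fin.toℕ<n i) (Fin.toℕ<n j) eq)

  residue-cong : ∀ {a b} → a ≡ b ⟨mod n ⟩ → residue a ≡ residue b
  residue-cong {a} {b} eq = rep-injective (mod-trans (rep-residue a) (mod-trans eq (mod-sym (rep-residue b))))

  residue-rep : ∀ i → residue (rep i) ≡ i
  residue-rep i = rep-injective (rep-residue (rep i))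

  mod? : ∀ a b → Dec (a ≡ b ⟨mod n ⟩)
  mod? a b with residue a Fin.≟ residue b
  ... | yes eq = yes (mod-trans (mod-sym (rep-residue a)) (mod-trans (≡⇒mod (cong rep eq)) (rep-residue b)))
  ... | no neq = no (λ eq → neq (residue-cong eq))

-- The wreath product of ℤ/m by the dihedral group of order 2k

-- `FinGroup` asks for a group up to `_≡_`, while the wreath product is easiest to build up to
-- congruence. A bijection between the classes of a setoid and `Fin n` carries the structure over.
module Transport (Γ : Group 0ℓ 0ℓ) {n : ℕ} where
  open Group Γ using (Carrier; _≈_; _∙_; ε; _⁻¹) renaming (trans to ≈-trans; sym to ≈-sym; refl to ≈-refl)
  module Γ = Group Γ

  module _ (encode : Carrier → Fin n) (decode : Fin n → Carrier)
           (encode-cong : ∀ {x y} → x ≈ y → encode x ≡ encode y)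
           (encode-decode : ∀ i → encode (decode i) ≡ i)
           (decode-encode : ∀ x → decode (encode x) ≈ x) where

    finGroup : FinGroup n
    finGroup = record
      { _∙_ = λ i j → encode (decode i ∙ decode j)
      ; ε   = encode ε
      ; _⁻¹ = λ i → encode (decode i ⁻¹)
      ; isGroup = record
        { isMonoid = record
          { isSemigroup = record
            { isMagma = record
              { isEquivalence = isEquivalence
              ; ∙-cong = cong₂ (λ i j → encode (decode i ∙ decode j)) }
            ; assoc = λ i j l → encode-cong
                (≈-trans (Γ.∙-congʳ (decode-encode _))
                (≈-trans (Γ.assoc _ _ _)
                         (Γ.∙-congˡ (≈-sym (decode-encode _))))) }
          ; identity =
              (λ i → trans (encode-cong (≈-trans (Γ.∙-congʳ (decode-encode _)) (Γ.identityˡ _))) (encode-decode i))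
            , (λ i → trans (encode-cong (≈-trans (Γ.∙-congˡ (decode-encode _)) (Γ.identityʳ _))) (encode-decode i)) }
        ; inverse =
              (λ i → encode-cong (≈-trans (Γ.∙-congʳ (decode-encode _)) (Γ.inverseˡ _)))
            , (λ i → encode-cong (≈-trans (Γ.∙-congˡ (decode-encode _)) (Γ.inverseʳ _)))
        ; ⁻¹-cong = cong (λ i → encode (decode i ⁻¹)) } }

-- The infinite dihedral group acting on integer cells.

pattern up   = zero
pattern down = suc zero

State : Set
State = ℤ × Fin 2

flip : Fin 2 → Fin 2
flip up   = down
flip down = up

infixl 7 _⊙_

_⊙_ : State → State → State
(q , up)   ⊙ (q′ , d) = q + q′ , d
(q , down) ⊙ (q′ , d) = q - q′ , flip d

-- Position q is the boundary between the cells q - 1 and q, and `act g x` is the cell x places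
-- ahead in the direction of g, counted from zero; hence the offset `1ℤ`. `_⊙_` composes these maps.
act : State → ℤ → ℤ
act (q , up)   x = x + q
act (q , down) x = q - 1ℤ - x

act⁻¹ : State → ℤ → ℤ
act⁻¹ (q , up)   x = x - q
act⁻¹ (q , down) x = q - 1ℤ - x

infixl 8 _⁻

_⁻ : State → State
(q , up)   ⁻ = - q , up
(q , down) ⁻ = q , down

⊙-assoc : ∀ g h l → g ⊙ h ⊙ l ≡ g ⊙ (h ⊙ l)
⊙-assoc (q , up)   (q′ , up)   (q″ , d) = cong (_, d) (ℤ.+-assoc q q′ q″)
⊙-assoc (q , up)   (q′ , down) (q″ , d) = cong (_, flip d) (ℤ.+-assoc q q′ (- q″))
⊙-assoc (q , down) (q′ , up)   (q″ , d) = cong (_, flip d) (lemma q q′ q″)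
  where
  lemma : ∀ a b c → a - b - c ≡ a - (b + c)
  lemma = solve-∀
⊙-assoc (q , down) (q′ , down) (q″ , d) = cong₂ _,_ (lemma q q′ q″) (flip-flip d)
  where
  lemma : ∀ a b c → a - b + c ≡ a - (b - c)
  lemma = solve-∀
  flip-flip : ∀ d → d ≡ flip (flip d)
  flip-flip up   = refl
  flip-flip down = refl

⊙-identityˡ : ∀ g → (0ℤ , up) ⊙ g ≡ g
⊙-identityˡ (q , d) = cong (_, d) (ℤ.+-identityˡ q)

⊙-identityʳ : ∀ g → g ⊙ (0ℤ , up) ≡ g
⊙-identityʳ (q , up)   = cong (_, up) (ℤ.+-identityʳ q)
⊙-identityʳ (q , down) = cong (_, down) (ℤ.+-identityʳ q)

⊙-inverseˡ : ∀ g → g ⁻ ⊙ g ≡ (0ℤ , up)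
⊙-inverseˡ (q , up)   = cong (_, up) (ℤ.+-inverseˡ q)
⊙-inverseˡ (q , down) = cong (_, up) (ℤ.+-inverseʳ q)

⊙-inverseʳ : ∀ g → g ⊙ g ⁻ ≡ (0ℤ , up)
⊙-inverseʳ (q , up)   = cong (_, up) (ℤ.+-inverseʳ q)
⊙-inverseʳ (q , down) = cong (_, up) (ℤ.+-inverseʳ q)

-- This order reversal yields associativity in the wreath product, where the second function is
-- translated along `act⁻¹`.
act⁻¹-⊙ : ∀ g h x → act⁻¹ (g ⊙ h) x ≡ act⁻¹ h (act⁻¹ g x)
act⁻¹-⊙ (q , up)   (q′ , up)   x = lemma q q′ x
  where
  lemma : ∀ q q′ x → x - (q + q′) ≡ x - q - q′
  lemma = solve-∀
act⁻¹-⊙ (q , up)   (q′ , down) x = lemma q q′ x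
  where
  lemma : ∀ q q′ x → q + q′ - 1ℤ - x ≡ q′ - 1ℤ - (x - q)
  lemma = solve-∀
act⁻¹-⊙ (q , down) (q′ , up)   x = lemma q q′ x
  where
  lemma : ∀ q q′ x → q - q′ - 1ℤ - x ≡ q - 1ℤ - x - q′
  lemma = solve-∀
act⁻¹-⊙ (q , down) (q′ , down) x = lemma q q′ x
  where
  lemma : ∀ q q′ x → x - (q - q′) ≡ q′ - 1ℤ - (q - 1ℤ - x)
  lemma = solve-∀

act⁻¹-⁻ : ∀ g x → act⁻¹ (g ⁻) x ≡ act g x
act⁻¹-⁻ (q , up)   x = cong (λ p → x + p) (ℤ.neg-involutive q)
act⁻¹-⁻ (q , down) x = refl

act-act⁻¹ : ∀ g x → act g (act⁻¹ g x) ≡ x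
act-act⁻¹ (q , up)   x = lemma q x
  where
  lemma : ∀ q x → x - q + q ≡ x
  lemma = solve-∀
act-act⁻¹ (q , down) x = lemma q x
  where
  lemma : ∀ q x → q - 1ℤ - (q - 1ℤ - x) ≡ x
  lemma = solve-∀

act⁻¹-identity : ∀ x → act⁻¹ (0ℤ , up) x ≡ x
act⁻¹-identity = ℤ.+-identityʳ

-- The wreath product up to congruence.

module Wreath (k m : ℕ) where

  infix 4 _≈ˢ_ _≈_

  _≈ˢ_ : State → State → Set
  (q , d) ≈ˢ (q′ , d′) = q ≡ q′ ⟨mod k ⟩ × d ≡ d′

  ≡⇒≈ˢ : ∀ {g h} → g ≡ h → g ≈ˢ h
  ≡⇒≈ˢ refl = ≡⇒mod refl , refl

  ≈ˢ-sym : ∀ {g h} → g ≈ˢ h → h ≈ˢ g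
  ≈ˢ-sym (p , e) = mod-sym p , sym e

  ≈ˢ-trans : ∀ {g h l} → g ≈ˢ h → h ≈ˢ l → g ≈ˢ l
  ≈ˢ-trans (p , e) (p′ , e′) = mod-trans p p′ , trans e e′

  ⊙-cong : ∀ {g g′ h h′} → g ≈ˢ g′ → h ≈ˢ h′ → g ⊙ h ≈ˢ g′ ⊙ h′
  ⊙-cong {_ , up}   (p , refl) (p′ , refl) = mod-+ p p′ , refl
  ⊙-cong {_ , down} (p , refl) (p′ , refl) = mod-- p p′ , refl

  ⁻-cong : ∀ {g g′} → g ≈ˢ g′ → g ⁻ ≈ˢ g′ ⁻
  ⁻-cong {_ , up}   (p , refl) = mod-neg p , refl
  ⁻-cong {_ , down} (p , refl) = p , refl

  act⁻¹-cong : ∀ {g g′ x y} → g ≈ˢ g′ → x ≡ y ⟨mod k ⟩ → act⁻¹ g x ≡ act⁻¹ g′ y ⟨mod k ⟩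
  act⁻¹-cong {_ , up}   (p , refl) e = mod-- e p
  act⁻¹-cong {_ , down} (p , refl) e = mod-- (mod-- p (≡⇒mod refl)) e

  act-cong : ∀ {g g′ x y} → g ≈ˢ g′ → x ≡ y ⟨mod k ⟩ → act g x ≡ act g′ y ⟨mod k ⟩
  act-cong {_ , up}   (p , refl) e = mod-+ e p
  act-cong {_ , down} (p , refl) e = mod-- (mod-- p (≡⇒mod refl)) e

  -- Integer data stand for their classes: positions and arguments of fun modulo k, values of fun modulo m.
  record Element : Set where
    constructor element
    field
      fun     : ℤ → ℤ
      state   : State
      respect : ∀ {x y} → x ≡ y ⟨mod k ⟩ → fun x ≡ fun y ⟨mod m ⟩

  open Element public

  record _≈_ (a b : Element) : Set where
    constructor _,_
    field
      fun-≈   : ∀ x → fun a x ≡ fun b x ⟨mod m ⟩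
      state-≈ : state a ≈ˢ state b

  open _≈_ public

  _*ᵂ_ : Element → Element → Element
  element f g f-resp *ᵂ element f′ g′ f′-resp =
    element (λ x → f x + f′ (act⁻¹ g x)) (g ⊙ g′)
            (λ e → mod-+ (f-resp e) (f′-resp (act⁻¹-cong {g} (≡⇒≈ˢ refl) e)))

  εᵂ : Element
  εᵂ = element (λ _ → 0ℤ) (0ℤ , up) (λ _ → ≡⇒mod refl)

  invᵂ : Element → Element
  invᵂ (element f g f-resp) =
    element (λ x → - f (act g x)) (g ⁻) (λ e → mod-neg (f-resp (act-cong {g} (≡⇒≈ˢ refl) e)))

  wreath : Group 0ℓ 0ℓ
  wreath = record
    { Carrier = Element ; _≈_ = _≈_ ; _∙_ = _*ᵂ_ ; ε = εᵂ ; _⁻¹ = invᵂ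
    ; isGroup = record
      { isMonoid = record
        { isSemigroup = record
          { isMagma = record
            { isEquivalence = record
              { refl  = (λ _ → ≡⇒mod refl) , ≡⇒≈ˢ refl
              ; sym   = λ (p , e) → (λ x → mod-sym (p x)) , ≈ˢ-sym e
              ; trans = λ (p , e) (p′ , e′) → (λ x → mod-trans (p x) (p′ x)) , ≈ˢ-trans e e′ }
            ; ∙-cong = λ {a} {a′} {b} {b′} (p , e) (p′ , e′) →
                (λ x → mod-+ (p x) (mod-trans (respect b (act⁻¹-cong {state a} e (≡⇒mod refl))) (p′ _)))
                , ⊙-cong {state a} e e′ }
          ; assoc = λ a b c →
              (λ x → ≡⇒mod (trans (ℤ.+-assoc (fun a x) _ _)
                (cong (λ y → fun a x + (fun b (act⁻¹ (state a) x) + fun c y)) (act⁻¹-⊙ (state a) (state b) x))))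
              , ≡⇒≈ˢ (⊙-assoc (state a) (state b) (state c)) }
        ; identity =
            (λ a → (λ x → ≡⇒mod (trans (ℤ.+-identityˡ _) (cong (fun a) (act⁻¹-identity x))))
                   , ≡⇒≈ˢ (⊙-identityˡ (state a)))
          , (λ a → (λ x → ≡⇒mod (ℤ.+-identityʳ _)) , ≡⇒≈ˢ (⊙-identityʳ (state a))) }
      ; inverse =
          (λ a → (λ x → ≡⇒mod (trans (cong (λ y → - fun a (act (state a) x) + fun a y) (act⁻¹-⁻ (state a) x))
                                     (ℤ.+-inverseˡ (fun a (act (state a) x)))))
                 , ≡⇒≈ˢ (⊙-inverseˡ (state a)))
        , (λ a → (λ x → ≡⇒mod (trans (cong (λ y → fun a x + - fun a y) (act-act⁻¹ (state a) x))
                                     (ℤ.+-inverseʳ (fun a x))))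
                 , ≡⇒≈ˢ (⊙-inverseʳ (state a)))
      ; ⁻¹-cong = λ {a} {a′} (p , e) →
          (λ x → mod-neg (mod-trans (respect a (act-cong {state a} e (≡⇒mod refl))) (p _)))
          , ⁻-cong {state a} e } }

-- Encoding the wreath product in a finite set.

funToFin-cong : ∀ {k m} {f f′ : Fin k → Fin m} → f ≗ f′ → funToFin f ≡ funToFin f′
funToFin-cong {zero}  eq = refl
funToFin-cong {suc k} eq = cong₂ combine (eq zero) (funToFin-cong (eq ∘ suc))

module FiniteWreath (k m : ℕ) .{{_ : ℕ.NonZero k}} .{{_ : ℕ.NonZero m}} where
  open Wreath k m public
  module ℤₖ = Residue k
  module ℤₘ = Residue m

  -- Sealed so that `encode` and `decode` do not unfold into digit arithmetic; what follows uses
  -- only the laws proved in this block.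
  abstract
    encode : Element → Fin (2 ℕ.* k ℕ.* m ℕ.^ k)
    encode a = combine (combine (proj₂ (state a)) (ℤₖ.residue (proj₁ (state a))))
                       (funToFin (λ i → ℤₘ.residue (fun a (ℤₖ.rep i))))

    decode′ : Fin 2 × Fin k → Fin (m ℕ.^ k) → Element
    decode′ (d , q) f = element (λ x → ℤₘ.rep (finToFun f (ℤₖ.residue x))) (ℤₖ.rep q , d)
                                (λ e → ≡⇒mod (cong (ℤₘ.rep ∘ finToFun f) (ℤₖ.residue-cong e)))

    decode : Fin (2 ℕ.* k ℕ.* m ℕ.^ k) → Element
    decode i = decode′ (remQuot k (proj₁ (remQuot (m ℕ.^ k) i))) (proj₂ (remQuot {2 ℕ.* k} (m ℕ.^ k) i))

    encode-cong : ∀ {a b} → a ≈ b → encode a ≡ encode b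
    encode-cong (p , (e , e′)) = cong₂ combine (cong₂ combine e′ (ℤₖ.residue-cong e))
      (funToFin-cong (λ i → ℤₘ.residue-cong (p (ℤₖ.rep i))))

    encode-decode : ∀ i → encode (decode i) ≡ i
    encode-decode i = trans (cong₂ combine
        (trans (cong (combine d) (ℤₖ.residue-rep q)) (Fin.combine-remQuot {2} k (proj₁ digits)))
        (trans (funToFin-cong (λ j → trans (ℤₘ.residue-rep _) (cong (finToFun _) (ℤₖ.residue-rep j))))
               (Fin.funToFin-finToFin {k} _)))
      (Fin.combine-remQuot {2 ℕ.* k} (m ℕ.^ k) i)
      where
      digits : Fin (2 ℕ.* k) × Fin (m ℕ.^ k)
      digits = remQuot {2 ℕ.* k} (m ℕ.^ k) i
      d : Fin 2
      d = proj₁ (remQuot {2} k (proj₁ digits))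
      q : Fin k
      q = proj₂ (remQuot {2} k (proj₁ digits))

    decode-combine : ∀ d q f → decode (combine (combine d q) f) ≡ decode′ (d , q) f
    decode-combine d q f = trans
      (cong (λ (i , f) → decode′ (remQuot k i) f) (Fin.remQuot-combine {2 ℕ.* k} (combine d q) f))
      (cong (λ i → decode′ i f) (Fin.remQuot-combine {2} d q))

    decode-encode : ∀ a → decode (encode a) ≈ a
    decode-encode a = subst (_≈ a) (sym (decode-combine _ _ _))
      ( (λ x → mod-trans (≡⇒mod (cong ℤₘ.rep (Fin.finToFun-funToFin _ (ℤₖ.residue x))))
                         (mod-trans (ℤₘ.rep-residue _) (respect a (ℤₖ.rep-residue x))))
      , (ℤₖ.rep-residue _ , refl))

  G : FinGroup (2 ℕ.* k ℕ.* m ℕ.^ k)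
  G = Transport.finGroup wreath encode decode encode-cong encode-decode decode-encode

-- Words and the vectors they span

data Letter : Set where
  r s : Letter

step : State → Letter → State
step (q , up)   r = q + + 2 , up
step (q , up)   s = q , down
step (q , down) r = q - + 2 , down
step (q , down) s = q , up

end : State → List Letter → State
end g []      = g
end g (l ∷ W) = end (step g l) W

end-++ : ∀ g W W′ → end g (W ++ W′) ≡ end (end g W) W′
end-++ g []      W′ = refl
end-++ g (l ∷ W) W′ = end-++ (step g l) W W′

module Words (k : ℕ) .{{_ : ℕ.NonZero k}} where
  open Residue k

  -- Vectors of ℤ^k appear as k-periodic functions on ℤ; this one is e₀.
  δ : ℤ → ℤ
  δ x with mod? x 0ℤ
  ... | yes _ = 1ℤ
  ... | no  _ = 0ℤ

  δ-hit : ∀ {x} → x ≡ 0ℤ ⟨mod k ⟩ → δ x ≡ 1ℤ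
  δ-hit {x} p with mod? x 0ℤ
  ... | yes _ = refl
  ... | no ¬p = contradiction p ¬p

  δ-miss : ∀ {x} → ¬ x ≡ 0ℤ ⟨mod k ⟩ → δ x ≡ 0ℤ
  δ-miss {x} ¬p with mod? x 0ℤ
  ... | yes p = contradiction p ¬p
  ... | no  _ = refl

  δ-iff : ∀ {x y} → (x ≡ 0ℤ ⟨mod k ⟩ → y ≡ 0ℤ ⟨mod k ⟩) → (y ≡ 0ℤ ⟨mod k ⟩ → x ≡ 0ℤ ⟨mod k ⟩) → δ x ≡ δ y
  δ-iff {x} {y} f g with mod? x 0ℤ
  ... | yes p = sym (δ-hit (f p))
  ... | no ¬p = sym (δ-miss (λ q → ¬p (g q)))

  δ-cong : ∀ {x y} → x ≡ y ⟨mod k ⟩ → δ x ≡ δ y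
  δ-cong p = δ-iff (mod-trans (mod-sym p)) (mod-trans p)

  δ-neg : ∀ x → δ (- x) ≡ δ x
  δ-neg x = δ-iff (λ p → subst (_≡ 0ℤ ⟨mod k ⟩) (ℤ.neg-involutive x) (mod-neg p)) mod-neg

  -- Abstract so that c can be inferred from unit c.
  abstract
    unit : ℤ → ℤ → ℤ
    unit c x = δ (x - c)

    unit-def : ∀ c x → unit c x ≡ δ (x - c)
    unit-def c x = refl

  unit-reflect : ∀ a c x → a ≡ c → δ (a - x) ≡ unit c x
  unit-reflect a c x refl = trans (cong δ (lemma a x)) (trans (δ-neg (x - a)) (sym (unit-def a x)))
    where
    lemma : ∀ a x → a - x ≡ - (x - a)
    lemma = solve-∀

  pulse : Letter → ℤ → ℤ
  pulse r x = δ x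
  pulse s x = δ x + δ (x - 1ℤ)

  write : State → Letter → ℤ → ℤ
  write g l x = pulse l (act⁻¹ g x)

  eval : State → (W : List Letter) → Vec ℤ (length W) → ℤ → ℤ
  eval g []      []       x = 0ℤ
  eval g (l ∷ W) (v ∷ vs) x = v * write g l x + eval (step g l) W vs x

  -- Coefficients are integers and the equality is exact, so the words are independent of m;
  -- reduction modulo m enters only in `fills-all⇒surjective`.
  record Span (g : State) (W : List Letter) (f : ℤ → ℤ) : Set where
    constructor _,_
    field
      values   : Vec ℤ (length W)
      realises : eval g W values ≗ f

  span-cong : ∀ {g W f f′} → f ≗ f′ → Span g W f → Span g W f′
  span-cong eq (vs , p) = vs , λ x → trans (p x) (eq x)

  span-0 : ∀ g W → Span g W (λ _ → 0ℤ)
  span-0 g []      = [] , λ _ → refl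
  span-0 g (l ∷ W) with span-0 (step g l) W
  ... | vs , p = 0ℤ ∷ vs , λ x → trans (ℤ.+-identityˡ _) (p x)

  span-linear : ∀ {g} W {f f′} a → Span g W f → Span g W f′ → Span g W (λ x → f x + a * f′ x)
  span-linear []      {f} {f′} a ([] , p) ([] , p′) =
    [] , λ x → trans (lemma a) (cong₂ (λ y y′ → y + a * y′) (p x) (p′ x))
    where
    lemma : ∀ a → 0ℤ ≡ 0ℤ + a * 0ℤ
    lemma = solve-∀
  span-linear {g} (l ∷ W) a (v ∷ vs , p) (v′ ∷ vs′ , p′) =
    let (us , e) = span-linear {step g l} W a (vs , λ _ → refl) (vs′ , λ _ → refl) in
    v + a * v′ ∷ us , λ x →
      trans (cong (λ y → (v + a * v′) * write g l x + y) (e x))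
     (trans (lemma a v v′ (write g l x) (eval (step g l) W vs x) (eval (step g l) W vs′ x))
            (cong₂ (λ y y′ → y + a * y′) (p x) (p′ x)))
    where
    lemma : ∀ a v v′ w e e′ → (v + a * v′) * w + (e + a * e′) ≡ (v * w + e) + a * (v′ * w + e′)
    lemma = solve-∀

  span-head : ∀ {g l} W → Span g (l ∷ W) (write g l)
  span-head {g} {l} W with span-0 (step g l) W
  ... | vs , p = 1ℤ ∷ vs , λ x → trans (cong (λ y → 1ℤ * write g l x + y) (p x)) (lemma (write g l x))
    where
    lemma : ∀ a → 1ℤ * a + 0ℤ ≡ a
    lemma = solve-∀

  span-tail : ∀ {g l W f} → Span (step g l) W f → Span g (l ∷ W) f
  span-tail (vs , p) = 0ℤ ∷ vs , λ x → trans (ℤ.+-identityˡ _) (p x)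

  span-++ʳ : ∀ {g h f} W {W′} → end g W ≡ h → Span h W′ f → Span g (W ++ W′) f
  span-++ʳ []      refl sp = sp
  span-++ʳ (l ∷ W) e    sp = span-tail (span-++ʳ W e sp)

  span-++ˡ : ∀ {g f} W {W′} → Span g W f → Span g (W ++ W′) f
  span-++ˡ {g} []      {W′} ([] , p)     = span-cong p (span-0 g W′)
  span-++ˡ {g} (l ∷ W) {W′} (v ∷ vs , p) with span-++ˡ {step g l} W {W′} (vs , λ _ → refl)
  ... | us , e = v ∷ us , λ x → trans (cong (λ y → v * write g l x + y) (e x)) (p x)

  Fills : State → List Letter → ℤ → Set
  Fills g W c = Span g W (unit c)

  FillsPair : State → List Letter → ℤ → ℤ → Set
  FillsPair g W b c = Span g W (λ x → unit b x + unit c x)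

  fills-mod : ∀ {g W b c} → b ≡ c ⟨mod k ⟩ → Fills g W b → Fills g W c
  fills-mod {b = b} {c} p = span-cong (λ x →
    trans (unit-def b x) (trans (δ-cong (mod-- (≡⇒mod {a = x} refl) p)) (sym (unit-def c x))))

  -- An `s` writes two cells jointly; once one of them is filled, subtraction fills the other.
  pair⇒ˡ : ∀ {g W b c} → FillsPair g W b c → Fills g W c → Fills g W b
  pair⇒ˡ {W = W} {b} {c} p q = span-cong (λ x → lemma (unit b x) (unit c x)) (span-linear W (- 1ℤ) p q)
    where
    lemma : ∀ a b → a + b + (- 1ℤ) * b ≡ a
    lemma = solve-∀

  pair⇒ʳ : ∀ {g W b c} → FillsPair g W b c → Fills g W b → Fills g W c
  pair⇒ʳ {b = b} {c} p = pair⇒ˡ (span-cong (λ x → ℤ.+-comm (unit b x) (unit c x)) p)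

  r-up : ∀ {q} W → Fills (q , up) (r ∷ W) q
  r-up {q} W = span-cong (λ x → sym (unit-def q x)) (span-head W)

  r-down : ∀ {q c} W → q - 1ℤ ≡ c → Fills (q , down) (r ∷ W) c
  r-down {q} {c} W e = span-cong (λ x → unit-reflect (q - 1ℤ) c x e) (span-head W)

  s-up : ∀ {q c} W → q + 1ℤ ≡ c → FillsPair (q , up) (s ∷ W) q c
  s-up {q} W refl = span-cong
    (λ x → cong₂ _+_ (sym (unit-def q x)) (trans (cong δ (lemma x q)) (sym (unit-def (q + 1ℤ) x)))) (span-head W)
    where
    lemma : ∀ x q → x - q - 1ℤ ≡ x - (q + 1ℤ)
    lemma = solve-∀

  s-down : ∀ {q b c} W → q - 1ℤ ≡ b → q - + 2 ≡ c → FillsPair (q , down) (s ∷ W) b c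
  s-down {q} {b} {c} W e e′ = span-cong
    (λ x → cong₂ _+_ (unit-reflect (q - 1ℤ) b x e)
                     (trans (cong δ (lemma q x)) (unit-reflect (q - + 2) c x e′)))
    (span-head W)
    where
    lemma : ∀ q x → q - 1ℤ - x - 1ℤ ≡ q - + 2 - x
    lemma = solve-∀

  -- From unit vectors to arbitrary functions.

  combination : (ℤ → ℤ) → ℕ → ℤ → ℤ
  combination f zero    x = 0ℤ
  combination f (suc n) x = combination f n x + f (+ n) * unit (+ n) x

  combination-span : ∀ {g W} f n → (∀ c → Fills g W c) → Span g W (combination f n)
  combination-span {g} {W} f zero    fills = span-0 g W
  combination-span {g} {W} f (suc n) fills =
    span-linear W (f (+ n)) (combination-span f n fills) (fills (+ n))

  combination-∉ : ∀ f {n x} j → j ℕ.< k → x ≡ + j ⟨mod k ⟩ → n ℕ.≤ j → combination f n x ≡ 0ℤ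
  combination-∉ f {zero}      j j<k e n≤j = refl
  combination-∉ f {suc n} {x} j j<k e n<j = begin
    combination f n x + f (+ n) * unit (+ n) x ≡⟨ cong₂ (λ y z → y + f (+ n) * z)
                                                    (combination-∉ f j j<k e (ℕ.<⇒≤ n<j)) (trans (unit-def (+ n) x) (δ-miss miss)) ⟩
    0ℤ + f (+ n) * 0ℤ                          ≡⟨ lemma (f (+ n)) ⟩
    0ℤ                                         ∎
    where
    open ≡-Reasoning
    lemma : ∀ a → 0ℤ + a * 0ℤ ≡ 0ℤ
    lemma = solve-∀
    cancel : ∀ a b → a - b + b ≡ a
    cancel = solve-∀
    miss : ¬ x - + n ≡ 0ℤ ⟨mod k ⟩
    miss p = ℕ.<⇒≢ n<j (+[<n]-injective (ℕ.<-trans n<j j<k) j<k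
      (mod-trans (mod-sym (mod-trans (≡⇒mod (sym (cancel x (+ n)))) (mod-+ p (≡⇒mod refl)))) e))

  -- The bound n ≤ k keeps the classes of 0, ..., n - 1 distinct, so exactly one term of the sum
  -- survives at x.
  combination-∈ : ∀ f {n x} j → j ℕ.< k → x ≡ + j ⟨mod k ⟩ → j ℕ.< n → n ℕ.≤ k → combination f n x ≡ f (+ j)
  combination-∈ f {suc n} {x} j j<k e (s≤s j≤n) n<k with ℕ.m≤n⇒m<n∨m≡n j≤n
  ... | inj₁ j<n = begin
    combination f n x + f (+ n) * unit (+ n) x ≡⟨ cong₂ (λ y z → y + f (+ n) * z)
                                                    (combination-∈ f j j<k e j<n (ℕ.<⇒≤ n<k)) (trans (unit-def (+ n) x) (δ-miss miss)) ⟩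
    f (+ j) + f (+ n) * 0ℤ                     ≡⟨ lemma (f (+ j)) (f (+ n)) ⟩
    f (+ j)                                    ∎
    where
    open ≡-Reasoning
    lemma : ∀ a b → a + b * 0ℤ ≡ a
    lemma = solve-∀
    cancel : ∀ a b → a - b + b ≡ a
    cancel = solve-∀
    miss : ¬ x - + n ≡ 0ℤ ⟨mod k ⟩
    miss p = ℕ.<⇒≢ j<n (+[<n]-injective j<k n<k
      (mod-trans (mod-sym e) (mod-trans (≡⇒mod (sym (cancel x (+ n)))) (mod-+ p (≡⇒mod refl)))))
  ... | inj₂ refl = begin
    combination f n x + f (+ n) * unit (+ n) x ≡⟨ cong₂ (λ y z → y + f (+ n) * z)
                                                    (combination-∉ f j j<k e ℕ.≤-refl) (trans (unit-def (+ n) x) (δ-hit hit)) ⟩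
    0ℤ + f (+ n) * 1ℤ                          ≡⟨ lemma (f (+ n)) ⟩
    f (+ n)                                    ∎
    where
    open ≡-Reasoning
    lemma : ∀ a → 0ℤ + a * 1ℤ ≡ a
    lemma = solve-∀
    hit : x - + n ≡ 0ℤ ⟨mod k ⟩
    hit = mod-trans (mod-- e (≡⇒mod refl)) (≡⇒mod (ℤ.+-inverseʳ (+ n)))

  -- The sum of the f (c) e_c with 0 ≤ c < k takes the exact values of f at the representatives
  -- below k. Elsewhere f is periodic only modulo m, so the conclusion is a congruence.
  fills-all⇒surjective : ∀ {g W m} → (∀ c → Fills g W c) →
    ∀ f → (∀ {x y} → x ≡ y ⟨mod k ⟩ → f x ≡ f y ⟨mod m ⟩) →
    ∃ λ vs → ∀ x → eval g W vs x ≡ f x ⟨mod m ⟩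
  fills-all⇒surjective {g} {W} fills f f-resp with combination-span {g} {W} f k fills
  ... | vs , p = vs , λ x → mod-trans
    (≡⇒mod (trans (p x) (combination-∈ f (x %ℕ k) (n%ℕd<d x k) (%-mod x) (n%ℕd<d x k) ℕ.≤-refl)))
    (f-resp (mod-sym (%-mod x)))

-- Runs and blocks

record Covers (P : ℤ → Set) (lo : ℤ) (n : ℕ) : Set where
  constructor covers
  field
    cell : ∀ i → i ℕ.< n → P (lo + + i)

open Covers

module _ {P : ℤ → Set} where

  covers-0 : ∀ {lo} → Covers P lo 0
  covers-0 = covers λ _ ()

  covers-∷ʳ : ∀ {lo n} → Covers P lo n → P (lo + + n) → Covers P lo (suc n)
  covers-∷ʳ {lo} {n} cov p = covers go
    where
    go : ∀ i → i ℕ.< suc n → P (lo + + i)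
    go i (s≤s i≤n) with ℕ.m≤n⇒m<n∨m≡n i≤n
    ... | inj₁ i<n  = cell cov i i<n
    ... | inj₂ refl = p

  covers-∷ˡ : ∀ {lo lo′ n} → lo + 1ℤ ≡ lo′ → P lo → Covers P lo′ n → Covers P lo (suc n)
  covers-∷ˡ {lo} {n = n} e p cov = covers go
    where
    go : ∀ i → i ℕ.< suc n → P (lo + + i)
    go zero    _         = subst P (sym (ℤ.+-identityʳ lo)) p
    go (suc i) (s≤s i<n) = subst P (trans (cong (_+ + i) (sym e)) (ℤ.+-assoc lo 1ℤ (+ i))) (cell cov i i<n)

  covers-++ : ∀ {lo lo′ n n′} → lo + + n ≡ lo′ → Covers P lo n → Covers P lo′ n′ → Covers P lo (n′ ℕ.+ n)
  covers-++ {n′ = zero}   e cov cov′ = cov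
  covers-++ {lo} {n = n} {suc n′} refl cov cov′ = covers-∷ʳ
    (covers-++ refl cov (covers λ i i<n′ → cell cov′ i (ℕ.m<n⇒m<1+n i<n′)))
    (subst P (((∀ a b c → a + b + c ≡ a + (c + b)) ∋ solve-∀) lo (+ n) (+ n′)) (cell cov′ n′ ℕ.≤-refl))

  -- An `r` moves by two cells, so a run fills cells of one parity only; a second run, on the way
  -- back or a lap later, supplies the other.
  covers-zip : ∀ {lo} n → (∀ {i} → i ℕ.< n → P (lo + + 2 * + i)) → (∀ {i} → i ℕ.< n → P (lo + 1ℤ + + 2 * + i)) →
               Covers P lo (2 ℕ.* n)
  covers-zip zero    even odd = covers-0
  covers-zip {lo} (suc n) even odd = subst (Covers P lo) (sym (ℕ.*-suc 2 n))
    (covers-∷ʳ (covers-∷ʳ (covers-zip n (λ i<n → even (ℕ.m<n⇒m<1+n i<n)) (λ i<n → odd (ℕ.m<n⇒m<1+n i<n)))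
      (subst (λ j → P (lo + j)) (sym (ℤ.pos-* 2 n)) (even ℕ.≤-refl)))
      (subst P (trans (ℤ.+-assoc lo 1ℤ (+ 2 * + n)) (cong (λ j → lo + (1ℤ + j)) (sym (ℤ.pos-* 2 n)))) (odd ℕ.≤-refl)))

module Residues (k : ℕ) .{{_ : ℕ.NonZero k}} where
  open Residue k

  covers-all : ∀ {P : ℤ → Set} {lo} → (∀ {b c} → b ≡ c ⟨mod k ⟩ → P b → P c) → Covers P lo k → ∀ c → P c
  covers-all {P} {lo} P-mod cov c = P-mod
    (mod-trans (mod-+ (≡⇒mod {a = lo} refl) (mod-sym (%-mod (c - lo))))
               (≡⇒mod (((∀ a b → a + (b - a) ≡ b) ∋ solve-∀) lo c)))
    (cell cov ((c - lo) %ℕ k) (n%ℕd<d (c - lo) k))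

R : ℕ → List Letter
R n = replicate n r

block : List Letter
block = r ∷ s ∷ s ∷ r ∷ []

blocks : ℕ → List Letter
blocks zero    = []
blocks (suc n) = block ++ blocks n

length-blocks : ∀ n → length (blocks n) ≡ 4 ℕ.* n
length-blocks zero    = refl
length-blocks (suc n) = trans (cong (4 ℕ.+_) (length-blocks n)) (sym (ℕ.*-suc 4 n))

end-ups : ∀ q n → end (q , up) (R n) ≡ (q + + 2 * + n , up)
end-ups q zero    = cong (_, up) (sym (ℤ.+-identityʳ q))
end-ups q (suc n) = trans (end-ups _ n)
  (cong (_, up) (((∀ q n → q + + 2 + + 2 * n ≡ q + + 2 * (1ℤ + n)) ∋ solve-∀) q (+ n)))

end-downs : ∀ lo {q} n → q ≡ lo + + 2 * + n → end (q , down) (R n) ≡ (lo , down)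
end-downs lo zero    refl = cong (_, down) (ℤ.+-identityʳ lo)
end-downs lo (suc n) refl = end-downs lo n
  (((∀ lo n → lo + + 2 * (1ℤ + n) - + 2 ≡ lo + + 2 * n) ∋ solve-∀) lo (+ n))

end-blocks-up : ∀ q n → end (q , up) (blocks n) ≡ (q + + 4 * + n , up)
end-blocks-up q zero    = cong (_, up) (sym (ℤ.+-identityʳ q))
end-blocks-up q (suc n) = trans (end-blocks-up _ n)
  (cong (_, up) (((∀ q n → q + + 2 + + 2 + + 4 * n ≡ q + + 4 * (1ℤ + n)) ∋ solve-∀) q (+ n)))

end-blocks-down : ∀ lo {q} n → q ≡ lo + + 4 * + n → end (q , down) (blocks n) ≡ (lo , down)
end-blocks-down lo zero    refl = cong (_, down) (ℤ.+-identityʳ lo)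
end-blocks-down lo (suc n) refl = end-blocks-down lo n
  (((∀ lo n → lo + + 4 * (1ℤ + n) - + 2 - + 2 ≡ lo + + 4 * n) ∋ solve-∀) lo (+ n))

module Routes (k : ℕ) .{{_ : ℕ.NonZero k}} where
  open Words k
  open Residues k

  fills-≡ : ∀ {g W b c} → b ≡ c → Fills g W b → Fills g W c
  fills-≡ {g} {W} = subst (Fills g W)

  ups : ∀ q n {i} → i ℕ.< n → Fills (q , up) (R n) (q + + 2 * + i)
  ups q (suc n) {zero}  _         = fills-≡ (sym (ℤ.+-identityʳ q)) (r-up (R n))
  ups q (suc n) {suc i} (s≤s i<n) = fills-≡
    (((∀ q i → q + + 2 + + 2 * i ≡ q + + 2 * (1ℤ + i)) ∋ solve-∀) q (+ i)) (span-tail (ups _ n i<n))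

  -- Indexed from the final position `lo`, so that the cells come in the ascending order that
  -- `covers-zip` expects. The offset `1ℤ` arises because a downward state writes below its
  -- position.
  downs : ∀ lo {q} n {i} → q ≡ lo + + 2 * + n → i ℕ.< n → Fills (q , down) (R n) (lo + 1ℤ + + 2 * + i)
  downs lo (suc n) {i} refl (s≤s i≤n) with ℕ.m≤n⇒m<n∨m≡n i≤n
  ... | inj₁ i<n  = span-tail (downs lo n
    (((∀ lo n → lo + + 2 * (1ℤ + n) - + 2 ≡ lo + + 2 * n) ∋ solve-∀) lo (+ n)) i<n)
  ... | inj₂ refl = r-down (R n)
    (((∀ lo n → lo + + 2 * (1ℤ + n) - 1ℤ ≡ lo + 1ℤ + + 2 * n) ∋ solve-∀) lo (+ n))

  -- The two letters `r` fill q and q + 2 on their own. The first `s` then gives q + 3 from its pair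
  -- with q + 2, and the second, heading down, gives q + 1 from its pair with q.
  block-up : ∀ {q} W → Covers (Fills (q , up) (block ++ W)) q 4
  block-up {q} W = covers λ where
      0 _ → fills-≡ (sym (ℤ.+-identityʳ q)) cell₀
      1 _ → pair⇒ˡ (span-tail (span-tail (s-down (r ∷ W)
              (((∀ q → q + + 2 - 1ℤ ≡ q + 1ℤ) ∋ solve-∀) q) (((∀ q → q + + 2 - + 2 ≡ q) ∋ solve-∀) q)))) cell₀
      2 _ → cell₂
      3 _ → pair⇒ʳ (span-tail (s-up (s ∷ r ∷ W) (ℤ.+-assoc q (+ 2) 1ℤ))) cell₂
      (suc (suc (suc (suc _)))) (s≤s (s≤s (s≤s (s≤s ()))))
    where
    cell₀ : Fills (q , up) (block ++ W) q
    cell₀ = r-up (s ∷ s ∷ r ∷ W)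
    cell₂ : Fills (q , up) (block ++ W) (q + + 2)
    cell₂ = span-tail (span-tail (span-tail (r-up W)))

  -- The mirror image: the letters `r` fill lo + 3 and lo + 1, and the letters `s` then give lo from
  -- lo + 1 and lo + 2 from lo + 3.
  block-down : ∀ {lo q} W → q ≡ lo + + 4 → Covers (Fills (q , down) (block ++ W)) lo 4
  block-down {lo} W refl = covers λ where
      0 _ → fills-≡ (sym (ℤ.+-identityʳ lo)) (pair⇒ʳ (span-tail (s-down (s ∷ r ∷ W)
              (((∀ q → q + + 4 - + 2 - 1ℤ ≡ q + 1ℤ) ∋ solve-∀) lo)
              (((∀ q → q + + 4 - + 2 - + 2 ≡ q) ∋ solve-∀) lo))) cell₁)
      1 _ → cell₁
      2 _ → fills-≡ (((∀ q → q + + 4 - + 2 ≡ q + + 2) ∋ solve-∀) lo) (pair⇒ˡ (span-tail (span-tail (s-up (r ∷ W)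
              (((∀ q → q + + 4 - + 2 + 1ℤ ≡ q + + 3) ∋ solve-∀) lo)))) cell₃)
      3 _ → cell₃
      (suc (suc (suc (suc _)))) (s≤s (s≤s (s≤s (s≤s ()))))
    where
    cell₃ : Fills (lo + + 4 , down) (block ++ W) (lo + + 3)
    cell₃ = r-down (s ∷ s ∷ r ∷ W) (((∀ q → q + + 4 - 1ℤ ≡ q + + 3) ∋ solve-∀) lo)
    cell₁ : Fills (lo + + 4 , down) (block ++ W) (lo + 1ℤ)
    cell₁ = span-tail (span-tail (span-tail (r-down W (((∀ q → q + + 4 - + 2 - 1ℤ ≡ q + 1ℤ) ∋ solve-∀) lo))))

  blocks-up : ∀ q n → Covers (Fills (q , up) (blocks n)) q (4 ℕ.* n)
  blocks-up _ zero = covers-0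
  blocks-up q (suc n) = subst (Covers _ q) (trans (ℕ.+-comm (4 ℕ.* n) 4) (sym (ℕ.*-suc 4 n)))
    (covers-++ (((∀ q → q + + 4 ≡ q + + 2 + + 2) ∋ solve-∀) q) (block-up (blocks n))
      (covers λ i i<n → span-++ʳ block refl (cell (blocks-up _ n) i i<n)))

  blocks-down : ∀ lo {q} n → q ≡ lo + + 4 * + n → Covers (Fills (q , down) (blocks n)) lo (4 ℕ.* n)
  blocks-down lo zero _ = covers-0
  blocks-down lo (suc n) refl = subst (Covers _ lo) (sym (ℕ.*-suc 4 n))
    (covers-++ (cong (λ j → lo + j) (ℤ.pos-* 4 n))
      (covers λ i i<n → span-++ʳ block refl (cell (blocks-down lo n
        (((∀ lo n → lo + + 4 * (1ℤ + n) - + 2 - + 2 ≡ lo + + 4 * n) ∋ solve-∀) lo (+ n))) i i<n))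
      (block-down (blocks n) (((∀ lo n → lo + + 4 * (1ℤ + n) ≡ lo + + 4 * n + + 4) ∋ solve-∀) lo (+ n))))

-- Words filling every cell

module Reaching (k : ℕ) .{{_ : ℕ.NonZero k}} where
  open Words k
  open Residues k
  open Routes k
  open Covers

  start : State
  start = 0ℤ , up

  -- `position` is the integer where the machine halts, possibly laps away from q. Keeping it apart
  -- makes `end≡` an exact equality and confines reduction modulo k to `position≡q`.
  record Reaches (q : ℤ) (d : Fin 2) : Set where
    field
      word       : List Letter
      length≡k   : length word ≡ k
      position   : ℤ
      end≡       : end start word ≡ (position , d)
      position≡q : position ≡ q ⟨mod k ⟩
      fills      : ∀ c → Fills start word c

  pos-2*+4* : ∀ a i → + (2 ℕ.* a ℕ.+ 4 ℕ.* i) ≡ + 2 * + a + + 4 * + i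
  pos-2*+4* a i = trans (ℤ.pos-+ (2 ℕ.* a) (4 ℕ.* i)) (cong₂ _+_ (ℤ.pos-* 2 a) (ℤ.pos-* 4 i))

  -- Presents k as a polynomial in the run length and the number of blocks, so that congruences
  -- become identities for the ring solver; the t of `by-modulus` counts laps around the cycle.
  module Modulus (n a i : ℕ) (k≡ : n ℕ.+ (2 ℕ.* a ℕ.+ 4 ℕ.* i) ≡ k) where

    modulus : ℤ
    modulus = + n + (+ 2 * + a + + 4 * + i)

    modulus≡k : modulus ≡ + k
    modulus≡k = trans (cong (λ j → + n + j) (sym (pos-2*+4* a i)))
      (trans (sym (ℤ.pos-+ n _)) (cong +_ k≡))

    by-modulus : ∀ {b c} t → b ≡ c + t * modulus → b ≡ c ⟨mod k ⟩
    by-modulus {b} {c} t e = by t (trans e (cong (λ j → c + t * j) modulus≡k))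

  -- On the first lap the run fills the even cells below 2p and the blocks fill the next 4i cells,
  -- arriving at `q₂`, which is k - 1. It remains for `T` to fill that cell and, on the second lap,
  -- the odd cells below 2p.
  module TwoLaps (p i : ℕ) (k≡ : 1 ℕ.+ (2 ℕ.* p ℕ.+ 4 ℕ.* i) ≡ k) (T : List Letter) where

    W : List Letter
    W = R p ++ blocks i ++ T

    q₁ q₂ : ℤ
    q₁ = 0ℤ + + 2 * + p
    q₂ = q₁ + + 4 * + i

    even : ∀ {j} → j ℕ.< p → Fills start W (0ℤ + + 2 * + j)
    even j<p = span-++ˡ (R p) (ups 0ℤ p j<p)

    middle : Covers (Fills start W) q₁ (4 ℕ.* i)
    middle = covers λ j j<4i →
      span-++ʳ (R p) (end-ups 0ℤ p) (span-++ˡ (blocks i) (cell (blocks-up q₁ i) j j<4i))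

    tail : ∀ {f} → Span (q₂ , up) T f → Span start W f
    tail sp = span-++ʳ (R p) (end-ups 0ℤ p) (span-++ʳ (blocks i) (end-blocks-up q₁ i) sp)

    end-W : end start W ≡ end (q₂ , up) T
    end-W = trans (end-++ start (R p) (blocks i ++ T))
           (trans (cong (λ g → end g (blocks i ++ T)) (end-ups 0ℤ p))
           (trans (end-++ (q₁ , up) (blocks i) T) (cong (λ g → end g T) (end-blocks-up q₁ i))))

    length-W : length W ≡ p ℕ.+ (4 ℕ.* i ℕ.+ length T)
    length-W = trans (List.length-++ (R p))
      (cong₂ ℕ._+_ (List.length-replicate p)
        (trans (List.length-++ (blocks i)) (cong (ℕ._+ length T) (length-blocks i))))

    top : Fills start W q₂ → Covers (Fills start W) q₁ (suc (4 ℕ.* i))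
    top f = covers-∷ʳ middle (fills-≡ (cong (λ j → q₁ + j) (sym (ℤ.pos-* 4 i))) f)

    all : (∀ {j} → j ℕ.< p → Fills start W (0ℤ + 1ℤ + + 2 * + j)) → Fills start W q₂ → ∀ c → Fills start W c
    all odd f = covers-all fills-mod (subst (Covers (Fills start W) 0ℤ)
      (trans (((∀ p i → suc (4 ℕ.* i) ℕ.+ 2 ℕ.* p ≡ 1 ℕ.+ (2 ℕ.* p ℕ.+ 4 ℕ.* i)) ∋ ℕ-Solver.solve-∀) p i) k≡)
      (covers-++ (cong (λ j → 0ℤ + j) (ℤ.pos-* 2 p)) (covers-zip p even odd) (top f)))

  module _ (p i : ℕ) (k≡ : 1 ℕ.+ (2 ℕ.* p ℕ.+ 4 ℕ.* i) ≡ k) where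
    open Modulus 1 p i k≡

    -- Since k is odd, the step from k - 1 to k + 1 changes parity: the first `r` of the second run
    -- fills k - 1, the others fill 1, 3, ..., 2p - 1.
    reaches-two-laps : Reaches (+ 2 * + p + 1ℤ) up
    reaches-two-laps = record
      { word       = W
      ; length≡k   = trans length-W (trans (cong (λ l → p ℕ.+ (4 ℕ.* i ℕ.+ l)) (List.length-replicate (suc p)))
          (trans (((∀ p i → p ℕ.+ (4 ℕ.* i ℕ.+ suc p) ≡ 1 ℕ.+ (2 ℕ.* p ℕ.+ 4 ℕ.* i)) ∋ ℕ-Solver.solve-∀) p i) k≡))
      ; position   = q₂ + + 2 * + suc p
      ; end≡       = trans end-W (end-ups q₂ (suc p))
      ; position≡q = by-modulus 1ℤ (((∀ p i → 0ℤ + + 2 * p + + 4 * i + + 2 * (1ℤ + p) ≡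
          + 2 * p + 1ℤ + 1ℤ * (1ℤ + (+ 2 * p + + 4 * i))) ∋ solve-∀) (+ p) (+ i))
      ; fills      = all
          (λ {j} j<p → fills-mod (by-modulus 1ℤ (((∀ p i j → 0ℤ + + 2 * p + + 4 * i + + 2 * (1ℤ + j) ≡
            0ℤ + 1ℤ + + 2 * j + 1ℤ * (1ℤ + (+ 2 * p + + 4 * i))) ∋ solve-∀) (+ p) (+ i) (+ j)))
            (run (s≤s j<p)))
          (fills-≡ (ℤ.+-identityʳ q₂) (run ℕ.z<s))
      }
      where
      open TwoLaps p i k≡ (R (suc p))
      run : ∀ {j} → j ℕ.< suc p → Fills start W (q₂ + + 2 * + j)
      run j<p = tail (ups q₂ (suc p) j<p)

  module _ (p i : ℕ) (k≡ : 1 ℕ.+ (2 ℕ.* suc p ℕ.+ 4 ℕ.* i) ≡ k) where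
    open Modulus 1 (suc p) i k≡

    reaches-two-laps′ : Reaches (+ 2 * + p + 1ℤ) down
    reaches-two-laps′ = record
      { word       = W
      ; length≡k   = trans length-W (trans (cong (λ l → suc p ℕ.+ (4 ℕ.* i ℕ.+ l))
          (trans (List.length-++ (R (suc p))) (cong (ℕ._+ 1) (List.length-replicate (suc p)))))
          (trans (((∀ p i → p ℕ.+ (4 ℕ.* i ℕ.+ (p ℕ.+ 1)) ≡ 1 ℕ.+ (2 ℕ.* p ℕ.+ 4 ℕ.* i)) ∋ ℕ-Solver.solve-∀) (suc p) i) k≡))
      ; position   = q₃
      ; end≡       = trans end-W (trans (end-++ (q₂ , up) (R (suc p)) (s ∷ []))
                                        (cong (λ g → end g (s ∷ [])) (end-ups q₂ (suc p))))
      ; position≡q = q₃≡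
      ; fills      = all odd first
      }
      where
      open TwoLaps (suc p) i k≡ (R (suc p) ++ s ∷ [])
      q₃ : ℤ
      q₃ = q₂ + + 2 * + suc p
      q₃≡ : q₃ ≡ + 2 * + p + 1ℤ ⟨mod k ⟩
      q₃≡ = by-modulus 1ℤ (((∀ p i → 0ℤ + + 2 * (1ℤ + p) + + 4 * i + + 2 * (1ℤ + p) ≡
          + 2 * p + 1ℤ + 1ℤ * (1ℤ + (+ 2 * (1ℤ + p) + + 4 * i))) ∋ solve-∀) (+ p) (+ i))
      run : ∀ {j} → j ℕ.< suc p → Fills start W (q₂ + + 2 * + j)
      run j<p = tail (span-++ˡ (R (suc p)) (ups q₂ (suc p) j<p))
      first : Fills start W q₂
      first = fills-≡ (ℤ.+-identityʳ q₂) (run ℕ.z<s)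
      -- The closing `s` writes 2p + 1 jointly with 2p + 2, the cell just after the even run. The
      -- latter is the first block cell or, if i = 0, the cell k - 1; `top` includes both.
      last : Fills start W q₃
      last = pair⇒ˡ (tail (span-++ʳ (R (suc p)) (end-ups q₂ (suc p)) (s-up {q₃} [] refl)))
        (fills-mod (mod-sym (by-modulus 1ℤ (((∀ p i → 0ℤ + + 2 * p + + 4 * i + + 2 * p + 1ℤ ≡
            0ℤ + + 2 * p + 0ℤ + 1ℤ * (1ℤ + (+ 2 * p + + 4 * i))) ∋ solve-∀) (+ suc p) (+ i))))
          (cell (top first) 0 ℕ.z<s))
      odd : ∀ {j} → j ℕ.< suc p → Fills start W (0ℤ + 1ℤ + + 2 * + j)
      odd {j} (s≤s j≤p) with ℕ.m≤n⇒m<n∨m≡n j≤p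
      ... | inj₁ j<p  = fills-mod (by-modulus 1ℤ (((∀ p i j → 0ℤ + + 2 * p + + 4 * i + + 2 * (1ℤ + j) ≡
            0ℤ + 1ℤ + + 2 * j + 1ℤ * (1ℤ + (+ 2 * p + + 4 * i))) ∋ solve-∀) (+ suc p) (+ i) (+ j)))
            (run (s≤s j<p))
      ... | inj₂ refl = fills-mod (mod-trans q₃≡
            (≡⇒mod (((∀ p → + 2 * p + 1ℤ ≡ 0ℤ + 1ℤ + + 2 * p) ∋ solve-∀) (+ p)))) last

  -- The blocks fill 0, ..., 4e - 1 and the run fills every other cell from 4e to k - 3. The turn at
  -- `q₂`, which is k - 1, writes k - 1 jointly with k, that is 0. It remains for `T` to fill the
  -- gaps on the way back.
  module UpAndBack (b e : ℕ) (k≡ : 1 ℕ.+ (2 ℕ.* b ℕ.+ 4 ℕ.* e) ≡ k) (T : List Letter) where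
    open Modulus 1 b e k≡

    W : List Letter
    W = blocks e ++ R b ++ s ∷ T

    q₁ q₂ : ℤ
    q₁ = 0ℤ + + 4 * + e
    q₂ = q₁ + + 2 * + b

    low : Covers (Fills start W) 0ℤ (4 ℕ.* e)
    low = covers λ j j<4e → span-++ˡ (blocks e) (cell (blocks-up 0ℤ e) j j<4e)

    even : ∀ {j} → j ℕ.< b → Fills start W (q₁ + + 2 * + j)
    even j<b = span-++ʳ (blocks e) (end-blocks-up 0ℤ e) (span-++ˡ (R b) (ups q₁ b j<b))

    pair : FillsPair start W q₂ (q₂ + 1ℤ)
    pair = span-++ʳ (blocks e) (end-blocks-up 0ℤ e) (span-++ʳ (R b) (end-ups q₁ b) (s-up T refl))

    tail : ∀ {f} → Span (q₂ , down) T f → Span start W f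
    tail sp = span-++ʳ (blocks e) (end-blocks-up 0ℤ e) (span-++ʳ (R b) (end-ups q₁ b) (span-tail sp))

    end-W : end start W ≡ end (q₂ , down) T
    end-W = trans (end-++ start (blocks e) (R b ++ s ∷ T))
           (trans (cong (λ g → end g (R b ++ s ∷ T)) (end-blocks-up 0ℤ e))
           (trans (end-++ (q₁ , up) (R b) (s ∷ T)) (cong (λ g → end g (s ∷ T)) (end-ups q₁ b))))

    length-W : length W ≡ 4 ℕ.* e ℕ.+ (b ℕ.+ suc (length T))
    length-W = trans (List.length-++ (blocks e))
      (cong₂ ℕ._+_ (length-blocks e)
        (trans (List.length-++ (R b)) (cong (ℕ._+ suc (length T)) (List.length-replicate b))))

    all : 1 ℕ.< k → (∀ {j} → j ℕ.< b → Fills start W (q₁ + 1ℤ + + 2 * + j)) → ∀ c → Fills start W c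
    all 1<k odd = covers-all fills-mod (subst (Covers (Fills start W) 0ℤ) k≡ (covers-∷ʳ below
      -- Cell 0 releases k - 1 from the pair; it is already filled because `below` has k - 1 > 0
      -- cells.
      (fills-≡ top≡ (pair⇒ˡ pair (fills-mod (mod-sym (by-modulus 1ℤ
        (((∀ b e → 0ℤ + + 4 * e + + 2 * b + 1ℤ ≡ 0ℤ + 1ℤ * (1ℤ + (+ 2 * b + + 4 * e))) ∋ solve-∀) (+ b) (+ e))))
        (cell below 0 (ℕ.s<s⁻¹ (subst (1 ℕ.<_) (sym k≡) 1<k))))))))
      where
      below : Covers (Fills start W) 0ℤ (2 ℕ.* b ℕ.+ 4 ℕ.* e)
      below = covers-++ (cong (λ j → 0ℤ + j) (ℤ.pos-* 4 e)) low (covers-zip b even odd)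
      top≡ : q₂ ≡ 0ℤ + + (2 ℕ.* b ℕ.+ 4 ℕ.* e)
      top≡ = trans (((∀ b e → 0ℤ + e + b ≡ 0ℤ + (b + e)) ∋ solve-∀) (+ 2 * + b) (+ 4 * + e))
                   (cong (λ j → 0ℤ + j) (sym (pos-2*+4* b e)))

  module _ (b e : ℕ) (k≡ : 1 ℕ.+ (2 ℕ.* b ℕ.+ 4 ℕ.* e) ≡ k) (1<k : 1 ℕ.< k) where

    reaches-up-and-back : Reaches (+ 4 * + e) down
    reaches-up-and-back = record
      { word       = W
      ; length≡k   = trans length-W (trans (cong (λ l → 4 ℕ.* e ℕ.+ (b ℕ.+ suc l)) (List.length-replicate b))
          (trans (((∀ b e → 4 ℕ.* e ℕ.+ (b ℕ.+ suc b) ≡ 1 ℕ.+ (2 ℕ.* b ℕ.+ 4 ℕ.* e)) ∋ ℕ-Solver.solve-∀) b e) k≡))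
      ; position   = q₁
      ; end≡       = trans end-W (end-downs q₁ b refl)
      ; position≡q = ≡⇒mod (ℤ.+-identityˡ (+ 4 * + e))
      ; fills      = all 1<k (λ j<b → tail (downs q₁ b refl j<b))
      }
      where open UpAndBack b e k≡ (R b)

  module _ (b e : ℕ) (k≡ : 1 ℕ.+ (2 ℕ.* suc b ℕ.+ 4 ℕ.* e) ≡ k) (1<k : 1 ℕ.< k) where

    reaches-up-and-back′ : Reaches (+ 4 * + e + + 2) up
    reaches-up-and-back′ = record
      { word       = W
      ; length≡k   = trans length-W (trans (cong (λ l → 4 ℕ.* e ℕ.+ (suc b ℕ.+ suc l))
          (trans (List.length-++ (R b)) (cong (ℕ._+ 1) (List.length-replicate b))))
          (trans (((∀ b e → 4 ℕ.* e ℕ.+ (suc b ℕ.+ suc (b ℕ.+ 1)) ≡ 1 ℕ.+ (2 ℕ.* suc b ℕ.+ 4 ℕ.* e)) ∋ ℕ-Solver.solve-∀) b e) k≡))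
      ; position   = q₃
      ; end≡       = trans end-W (trans (end-++ (q₂ , down) (R b) (s ∷ []))
                                        (cong (λ g → end g (s ∷ [])) (end-downs q₃ b q₂≡)))
      ; position≡q = ≡⇒mod (cong (_+ + 2) (ℤ.+-identityˡ (+ 4 * + e)))
      ; fills      = all 1<k odd
      }
      where
      open UpAndBack (suc b) e k≡ (R b ++ s ∷ [])
      q₃ : ℤ
      q₃ = q₁ + + 2
      q₂≡ : q₂ ≡ q₃ + + 2 * + b
      q₂≡ = ((∀ q b → q + + 2 * (1ℤ + b) ≡ q + + 2 + + 2 * b) ∋ solve-∀) q₁ (+ b)
      odd : ∀ {j} → j ℕ.< suc b → Fills start W (q₁ + 1ℤ + + 2 * + j)
      -- The closing `s`, at 4e + 2, writes 4e + 1 jointly with 4e, which the upward run filled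
      -- first.
      odd {zero} _ = fills-≡ (sym (ℤ.+-identityʳ (q₁ + 1ℤ))) (pair⇒ˡ
        (tail (span-++ʳ (R b) (end-downs q₃ b q₂≡) (s-down []
          (((∀ q → q + + 2 - 1ℤ ≡ q + 1ℤ) ∋ solve-∀) q₁) (((∀ q → q + + 2 - + 2 ≡ q + 0ℤ) ∋ solve-∀) q₁))))
        (even ℕ.z<s))
      odd {suc j} (s≤s j<b) = fills-≡
        (((∀ q j → q + + 2 + 1ℤ + + 2 * j ≡ q + 1ℤ + + 2 * (1ℤ + j)) ∋ solve-∀) q₁ (+ j))
        (tail (span-++ˡ (R b) (downs q₃ b q₂≡ j<b)))

  -- The run to 2a and back fills 0, ..., 2a - 1, the blocks go on down to -4i, and one more `r`
  -- fills -4i - 1, which is 2a + 2 modulo k. It remains for `T` to split the pair 2a, 2a + 1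
  -- written at the turn.
  module BackAndBeyond (a i : ℕ) (k≡ : 3 ℕ.+ (2 ℕ.* a ℕ.+ 4 ℕ.* i) ≡ k) (T : List Letter) where
    open Modulus 3 a i k≡

    W : List Letter
    W = R a ++ s ∷ (R a ++ blocks i ++ r ∷ T)

    q₁ q₂ : ℤ
    q₁ = 0ℤ + + 2 * + a
    q₂ = - (+ 4 * + i)

    0≡q₂+4i : 0ℤ ≡ q₂ + + 4 * + i
    0≡q₂+4i = sym (ℤ.+-inverseˡ (+ 4 * + i))

    even : ∀ {j} → j ℕ.< a → Fills start W (0ℤ + + 2 * + j)
    even j<a = span-++ˡ (R a) (ups 0ℤ a j<a)

    pair : FillsPair start W q₁ (q₁ + 1ℤ)
    pair = span-++ʳ (R a) (end-ups 0ℤ a) (s-up _ refl)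

    after-turn : ∀ {f} → Span (q₁ , down) (R a ++ blocks i ++ r ∷ T) f → Span start W f
    after-turn sp = span-++ʳ (R a) (end-ups 0ℤ a) (span-tail sp)

    odd : ∀ {j} → j ℕ.< a → Fills start W (0ℤ + 1ℤ + + 2 * + j)
    odd j<a = after-turn (span-++ˡ (R a) (downs 0ℤ a refl j<a))

    low : Covers (Fills start W) q₂ (4 ℕ.* i)
    low = covers λ j j<4i → after-turn (span-++ʳ (R a) (end-downs 0ℤ a refl)
      (span-++ˡ (blocks i) (cell (blocks-down q₂ i 0≡q₂+4i) j j<4i)))

    after-blocks : ∀ {f} → Span (q₂ , down) (r ∷ T) f → Span start W f
    after-blocks sp = after-turn (span-++ʳ (R a) (end-downs 0ℤ a refl)
      (span-++ʳ (blocks i) (end-blocks-down q₂ i 0≡q₂+4i) sp))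

    last : Fills start W (q₂ - 1ℤ)
    last = after-blocks (r-down T refl)

    tail : ∀ {f} → Span (q₂ - + 2 , down) T f → Span start W f
    tail sp = after-blocks (span-tail sp)

    end-W : end start W ≡ end (q₂ - + 2 , down) T
    end-W = trans (end-++ start (R a) (s ∷ (R a ++ blocks i ++ r ∷ T)))
           (trans (cong (λ g → end g (s ∷ (R a ++ blocks i ++ r ∷ T))) (end-ups 0ℤ a))
           (trans (end-++ (q₁ , down) (R a) (blocks i ++ r ∷ T))
           (trans (cong (λ g → end g (blocks i ++ r ∷ T)) (end-downs 0ℤ a refl))
           (trans (end-++ (0ℤ , down) (blocks i) (r ∷ T))
                  (cong (λ g → end g (r ∷ T)) (end-blocks-down q₂ i 0≡q₂+4i))))))

    length-W : length W ≡ a ℕ.+ suc (a ℕ.+ (4 ℕ.* i ℕ.+ suc (length T)))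
    length-W = trans (List.length-++ (R a)) (cong₂ ℕ._+_ (List.length-replicate a) (cong suc
      (trans (List.length-++ (R a)) (cong₂ ℕ._+_ (List.length-replicate a)
        (trans (List.length-++ (blocks i)) (cong (ℕ._+ suc (length T)) (length-blocks i)))))))

    below : Covers (Fills start W) q₂ (2 ℕ.* a ℕ.+ 4 ℕ.* i)
    below = covers-++ (trans (cong (λ j → q₂ + j) (ℤ.pos-* 4 i)) (ℤ.+-inverseˡ (+ 4 * + i)))
      low (covers-zip a even odd)

    at : ∀ x y → y + q₂ + (x + + (2 ℕ.* a ℕ.+ 4 ℕ.* i)) ≡ y + q₁ + x
    at x y = trans (cong (λ j → y + q₂ + (x + j)) (pos-2*+4* a i))
      (((∀ x y a i → y + - i + (x + (a + i)) ≡ y + (0ℤ + a) + x) ∋ solve-∀) x y (+ 2 * + a) (+ 4 * + i))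

    -- The cell -4i - 3 is 2a modulo k, so filling it splits the pair written at the turn.
    all : Fills start W (q₂ - + 3) → ∀ c → Fills start W c
    all f = covers-all fills-mod (subst (Covers (Fills start W) q₂) k≡
      (covers-∷ʳ (covers-∷ʳ (covers-∷ʳ below
        (place 0ℤ (fills-≡ (sym (ℤ.+-identityʳ q₁)) cell₀)))
        (place 1ℤ (pair⇒ʳ pair cell₀)))
        (place (+ 2) (fills-mod (by-modulus (- 1ℤ)
          (((∀ a i → - (+ 4 * i) - 1ℤ ≡ 0ℤ + + 2 * a + + 2 + (- 1ℤ) * (+ 3 + (+ 2 * a + + 4 * i))) ∋ solve-∀) (+ a) (+ i)))
          last))))
      where
      place : ∀ x → Fills start W (q₁ + x) → Fills start W (q₂ + (x + + (2 ℕ.* a ℕ.+ 4 ℕ.* i)))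
      place x = fills-≡ (sym (trans (sym (cong (_+ (x + + (2 ℕ.* a ℕ.+ 4 ℕ.* i))) (ℤ.+-identityˡ q₂)))
                             (trans (at x 0ℤ) (cong (_+ x) (ℤ.+-identityˡ q₁)))))
      cell₀ : Fills start W q₁
      cell₀ = fills-mod (by-modulus (- 1ℤ)
        (((∀ a i → - (+ 4 * i) - + 3 ≡ 0ℤ + + 2 * a + (- 1ℤ) * (+ 3 + (+ 2 * a + + 4 * i))) ∋ solve-∀) (+ a) (+ i))) f

  module _ (a i : ℕ) (k≡ : 3 ℕ.+ (2 ℕ.* a ℕ.+ 4 ℕ.* i) ≡ k) where
    open Modulus 3 a i k≡

    length-back-and-beyond : a ℕ.+ suc (a ℕ.+ (4 ℕ.* i ℕ.+ 2)) ≡ k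
    length-back-and-beyond = trans (((∀ a i → a ℕ.+ suc (a ℕ.+ (4 ℕ.* i ℕ.+ 2)) ≡ 3 ℕ.+ (2 ℕ.* a ℕ.+ 4 ℕ.* i)) ∋ ℕ-Solver.solve-∀) a i) k≡

    reaches-back-and-beyond : Reaches (+ 2 * + a - 1ℤ) down
    reaches-back-and-beyond = record
      { word       = W
      ; length≡k   = trans length-W length-back-and-beyond
      ; position   = q₂ - + 2 - + 2
      ; end≡       = end-W
      ; position≡q = by-modulus (- 1ℤ)
          (((∀ a i → - (+ 4 * i) - + 2 - + 2 ≡ + 2 * a - 1ℤ + (- 1ℤ) * (+ 3 + (+ 2 * a + + 4 * i))) ∋ solve-∀) (+ a) (+ i))
      ; fills      = all (tail (r-down [] (((∀ q → q - + 2 - 1ℤ ≡ q - + 3) ∋ solve-∀) q₂)))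
      }
      where open BackAndBeyond a i k≡ (r ∷ [])

    reaches-back-and-beyond′ : Reaches (+ 2 * + a + 1ℤ) up
    reaches-back-and-beyond′ = record
      { word       = W
      ; length≡k   = trans length-W length-back-and-beyond
      ; position   = q₂ - + 2
      ; end≡       = end-W
      ; position≡q = by-modulus (- 1ℤ)
          (((∀ a i → - (+ 4 * i) - + 2 ≡ + 2 * a + 1ℤ + (- 1ℤ) * (+ 3 + (+ 2 * a + + 4 * i))) ∋ solve-∀) (+ a) (+ i))
      -- The closing `s` writes -4i - 3 and -4i - 4. The latter is 2a - 1 modulo k: the top cell of
      -- `below`, or `last` when a = i = 0, so `last` is prepended.
      ; fills      = all (pair⇒ˡ
          (tail (s-down [] (((∀ q → q - + 2 - 1ℤ ≡ q - + 3) ∋ solve-∀) q₂) refl))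
          (fills-mod
            (mod-trans (≡⇒mod (trans (cong₂ _+_ (ℤ.+-comm q₂ (- 1ℤ)) (sym (ℤ.+-identityˡ (+ (2 ℕ.* a ℕ.+ 4 ℕ.* i))))) (at 0ℤ (- 1ℤ))))
              (by-modulus 1ℤ
                (((∀ a i → - 1ℤ + (0ℤ + + 2 * a) + 0ℤ ≡ - (+ 4 * i) - + 2 - + 2 + 1ℤ * (+ 3 + (+ 2 * a + + 4 * i))) ∋ solve-∀) (+ a) (+ i))))
            (cell (covers-∷ˡ (((∀ q → q - 1ℤ + 1ℤ ≡ q) ∋ solve-∀) q₂) last below) (2 ℕ.* a ℕ.+ 4 ℕ.* i) ℕ.≤-refl)))
      }
      where open BackAndBeyond a i k≡ (s ∷ [])

  -- The immediate turn leaves the pair 0, 1. The run fills -1, -3, ..., -2c + 1, the blocks fill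
  -- the 4i cells below -2c, and an `r` fills the next, which is 2 modulo k. Two cells further down
  -- is -k, so `T` re-enters at 0; it must fill 0, -2, ..., -2c.
  module Descent (c i : ℕ) (k≡ : 3 ℕ.+ (2 ℕ.* c ℕ.+ 4 ℕ.* i) ≡ k) (T : List Letter) where
    open Modulus 3 c i k≡

    W : List Letter
    W = s ∷ (R c ++ blocks i ++ r ∷ T)

    q₁ q₂ : ℤ
    q₁ = - (+ 2 * + c)
    q₂ = q₁ - + 4 * + i

    0≡q₁+2c : 0ℤ ≡ q₁ + + 2 * + c
    0≡q₁+2c = sym (ℤ.+-inverseˡ (+ 2 * + c))

    q₁≡q₂+4i : q₁ ≡ q₂ + + 4 * + i
    q₁≡q₂+4i = ((∀ q i → q ≡ q - i + i) ∋ solve-∀) q₁ (+ 4 * + i)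

    pair : FillsPair start W 0ℤ 1ℤ
    pair = s-up _ refl

    odd : ∀ {j} → j ℕ.< c → Fills start W (q₁ + 1ℤ + + 2 * + j)
    odd j<c = span-tail (span-++ˡ (R c) (downs q₁ c 0≡q₁+2c j<c))

    low : Covers (Fills start W) q₂ (4 ℕ.* i)
    low = covers λ j j<4i → span-tail (span-++ʳ (R c) (end-downs q₁ c 0≡q₁+2c)
      (span-++ˡ (blocks i) (cell (blocks-down q₂ i q₁≡q₂+4i) j j<4i)))

    after-blocks : ∀ {f} → Span (q₂ , down) (r ∷ T) f → Span start W f
    after-blocks sp = span-tail (span-++ʳ (R c) (end-downs q₁ c 0≡q₁+2c)
      (span-++ʳ (blocks i) (end-blocks-down q₂ i q₁≡q₂+4i) sp))

    last : Fills start W (q₂ - 1ℤ)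
    last = after-blocks (r-down T refl)

    tail : ∀ {f} → Span (q₂ - + 2 , down) T f → Span start W f
    tail sp = after-blocks (span-tail sp)

    end-W : end start W ≡ end (q₂ - + 2 , down) T
    end-W = trans (end-++ (0ℤ , down) (R c) (blocks i ++ r ∷ T))
           (trans (cong (λ g → end g (blocks i ++ r ∷ T)) (end-downs q₁ c 0≡q₁+2c))
           (trans (end-++ (q₁ , down) (blocks i) (r ∷ T))
                  (cong (λ g → end g (r ∷ T)) (end-blocks-down q₂ i q₁≡q₂+4i))))

    length-W : length W ≡ suc (c ℕ.+ (4 ℕ.* i ℕ.+ suc (length T)))
    length-W = cong suc
      (trans (List.length-++ (R c)) (cong₂ ℕ._+_ (List.length-replicate c)
        (trans (List.length-++ (blocks i)) (cong (ℕ._+ suc (length T)) (length-blocks i)))))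

    all : (∀ {j} → j ℕ.< c → Fills start W (q₁ + + 2 * + j)) → Fills start W 0ℤ → ∀ x → Fills start W x
    all even cell₀ = covers-all fills-mod (subst (Covers (Fills start W) q₂) k≡
      (covers-∷ʳ (covers-∷ʳ (covers-∷ʳ
        (covers-++ (trans (cong (λ j → q₂ + j) (ℤ.pos-* 4 i)) (sym q₁≡q₂+4i)) low (covers-zip c even odd))
        (place 0ℤ cell₀))
        (place 1ℤ (pair⇒ʳ pair cell₀)))
        (place (+ 2) (fills-mod (by-modulus (- 1ℤ)
          (((∀ c i → - (+ 2 * c) - + 4 * i - 1ℤ ≡ + 2 + (- 1ℤ) * (+ 3 + (+ 2 * c + + 4 * i))) ∋ solve-∀) (+ c) (+ i)))
          last))))
      where
      place : ∀ x → Fills start W x → Fills start W (q₂ + (x + + (2 ℕ.* c ℕ.+ 4 ℕ.* i)))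
      place x = fills-≡ (trans
        (((∀ x c i → x ≡ - c - i + (x + (c + i))) ∋ solve-∀) x (+ 2 * + c) (+ 4 * + i))
        (cong (λ j → q₂ + (x + j)) (sym (pos-2*+4* c i))))

  module _ (c i : ℕ) (k≡ : 3 ℕ.+ (2 ℕ.* c ℕ.+ 4 ℕ.* i) ≡ k) where
    open Modulus 3 c i k≡

    reaches-descent : Reaches (+ 4 * + i + + 2) down
    reaches-descent = record
      { word       = W
      ; length≡k   = trans length-W (trans (cong (λ l → suc (c ℕ.+ (4 ℕ.* i ℕ.+ suc l))) (List.length-replicate (suc c)))
          (trans (((∀ c i → suc (c ℕ.+ (4 ℕ.* i ℕ.+ suc (suc c))) ≡ 3 ℕ.+ (2 ℕ.* c ℕ.+ 4 ℕ.* i)) ∋ ℕ-Solver.solve-∀) c i) k≡))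
      ; position   = q₃
      ; end≡       = trans end-W (end-downs q₃ (suc c) q₃+2c≡)
      -- The word descends two laps: -4c - 4i - 4 is 4i + 2 - 2k.
      ; position≡q = by-modulus (- + 2)
          (((∀ c i → - (+ 2 * c) - + 4 * i - + 2 - + 2 * (1ℤ + c) ≡ + 4 * i + + 2 + (- + 2) * (+ 3 + (+ 2 * c + + 4 * i))) ∋ solve-∀) (+ c) (+ i))
      ; fills      = all
          (λ {j} j<c → fills-mod (by-modulus (- 1ℤ)
            (((∀ c i j → - (+ 2 * c) - + 4 * i - + 2 - + 2 * (1ℤ + c) + 1ℤ + + 2 * j ≡
              - (+ 2 * c) + + 2 * j + (- 1ℤ) * (+ 3 + (+ 2 * c + + 4 * i))) ∋ solve-∀) (+ c) (+ i) (+ j)))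
            (run (ℕ.m<n⇒m<1+n j<c)))
          (fills-mod (by-modulus (- 1ℤ)
            (((∀ c i → - (+ 2 * c) - + 4 * i - + 2 - + 2 * (1ℤ + c) + 1ℤ + + 2 * c ≡
              0ℤ + (- 1ℤ) * (+ 3 + (+ 2 * c + + 4 * i))) ∋ solve-∀) (+ c) (+ i)))
            (run ℕ.≤-refl))
      }
      where
      open Descent c i k≡ (R (suc c))
      q₃ : ℤ
      q₃ = q₂ - + 2 - + 2 * + suc c
      q₃+2c≡ : q₂ - + 2 ≡ q₃ + + 2 * + suc c
      q₃+2c≡ = ((∀ q c → q ≡ q - c + c) ∋ solve-∀) (q₂ - + 2) (+ 2 * + suc c)
      run : ∀ {j} → j ℕ.< suc c → Fills start W (q₃ + 1ℤ + + 2 * + j)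
      run j<c = tail (downs q₃ (suc c) q₃+2c≡ j<c)

  module _ (c i : ℕ) (k≡ : 3 ℕ.+ (2 ℕ.* suc c ℕ.+ 4 ℕ.* i) ≡ k) where
    open Modulus 3 (suc c) i k≡

    reaches-descent′ : Reaches (+ 4 * + i + + 4) up
    reaches-descent′ = record
      { word       = W
      ; length≡k   = trans length-W (trans (cong (λ l → suc (suc c ℕ.+ (4 ℕ.* i ℕ.+ suc l)))
          (trans (List.length-++ (R (suc c))) (cong (ℕ._+ 1) (List.length-replicate (suc c)))))
          (trans (((∀ c i → suc (c ℕ.+ (4 ℕ.* i ℕ.+ suc (c ℕ.+ 1))) ≡ 3 ℕ.+ (2 ℕ.* c ℕ.+ 4 ℕ.* i)) ∋ ℕ-Solver.solve-∀) (suc c) i) k≡))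
      ; position   = q₃
      ; end≡       = trans end-W (trans (end-++ (q₂ - + 2 , down) (R (suc c)) (s ∷ []))
                                        (cong (λ g → end g (s ∷ [])) (end-downs q₃ (suc c) q₃+2c≡)))
      ; position≡q = by-modulus (- + 2)
          (((∀ c i → - (+ 2 * c) - + 4 * i - + 2 - + 2 * c ≡ + 4 * i + + 4 + (- + 2) * (+ 3 + (+ 2 * c + + 4 * i))) ∋ solve-∀) (+ suc c) (+ i))
      ; fills      = all even
          (fills-mod (by-modulus (- 1ℤ)
            (((∀ c i → - (+ 2 * (1ℤ + c)) - + 4 * i - + 2 - + 2 * (1ℤ + c) + 1ℤ + + 2 * c ≡
              0ℤ + (- 1ℤ) * (+ 3 + (+ 2 * (1ℤ + c) + + 4 * i))) ∋ solve-∀) (+ c) (+ i)))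
            (run ℕ.≤-refl))
      }
      where
      open Descent (suc c) i k≡ (R (suc c) ++ s ∷ [])
      q₃ : ℤ
      q₃ = q₂ - + 2 - + 2 * + suc c
      q₃+2c≡ : q₂ - + 2 ≡ q₃ + + 2 * + suc c
      q₃+2c≡ = ((∀ q c → q ≡ q - c + c) ∋ solve-∀) (q₂ - + 2) (+ 2 * + suc c)
      run : ∀ {j} → j ℕ.< suc c → Fills start W (q₃ + 1ℤ + + 2 * + j)
      run j<c = tail (span-++ˡ (R (suc c)) (downs q₃ (suc c) q₃+2c≡ j<c))
      -- Partner of the cell that the closing `s` has to fill: the top block cell, or `last` if
      -- there are no blocks, so `last` is prepended.
      below-q₁ : Fills start W (q₁ - 1ℤ)
      below-q₁ = fills-≡
        (trans (cong (λ j → q₂ - 1ℤ + j) (ℤ.pos-* 4 i))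
               (((∀ q i → q - i - 1ℤ + i ≡ q - 1ℤ) ∋ solve-∀) q₁ (+ 4 * + i)))
        (cell (covers-∷ˡ (((∀ q → q - 1ℤ + 1ℤ ≡ q) ∋ solve-∀) q₂) last low) (4 ℕ.* i) ℕ.≤-refl)
      even : ∀ {j} → j ℕ.< suc c → Fills start W (q₁ + + 2 * + j)
      -- The lowest even cell, -2(c + 1), is missed by the shortened run and comes from the closing
      -- `s`.
      even {zero} _ = fills-mod (by-modulus (- 1ℤ)
          (((∀ c i → - (+ 2 * c) - + 4 * i - + 2 - + 2 * c - 1ℤ ≡
            - (+ 2 * c) + 0ℤ + (- 1ℤ) * (+ 3 + (+ 2 * c + + 4 * i))) ∋ solve-∀) (+ suc c) (+ i)))
        (pair⇒ˡ (tail (span-++ʳ (R (suc c)) (end-downs q₃ (suc c) q₃+2c≡) (s-down [] refl refl)))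
          (fills-mod (mod-sym (by-modulus (- 1ℤ)
            (((∀ c i → - (+ 2 * c) - + 4 * i - + 2 - + 2 * c - + 2 ≡
              - (+ 2 * c) - 1ℤ + (- 1ℤ) * (+ 3 + (+ 2 * c + + 4 * i))) ∋ solve-∀) (+ suc c) (+ i))))
            below-q₁))
      even {suc j} (s≤s j<c) = fills-mod (by-modulus (- 1ℤ)
          (((∀ c i j → - (+ 2 * c) - + 4 * i - + 2 - + 2 * c + 1ℤ + + 2 * j ≡
            - (+ 2 * c) + + 2 * (1ℤ + j) + (- 1ℤ) * (+ 3 + (+ 2 * c + + 4 * i))) ∋ solve-∀) (+ suc c) (+ i) (+ j)))
        (run (ℕ.m<n⇒m<1+n j<c))

-- Reaching all 2k states.

data Parity : ℕ → Set where
  even : ∀ n → Parity (2 ℕ.* n)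
  odd  : ∀ n → Parity (1 ℕ.+ 2 ℕ.* n)

parity : ∀ n → Parity n
parity zero = even 0
parity (suc n) with parity n
... | even h = odd h
... | odd h  = subst Parity (ℕ.*-suc 2 h) (even (suc h))

module AllStates (k : ℕ) .{{_ : ℕ.NonZero k}} (1<k : 1 ℕ.< k) where
  open Reaching k
  open Residue k

  reaches-mod : ∀ {q q′ d} → q ≡ q′ ⟨mod k ⟩ → Reaches q d → Reaches q′ d
  reaches-mod e reach = record
    { word = word ; length≡k = length≡k ; position = position ; end≡ = end≡
    ; position≡q = mod-trans position≡q e ; fills = fills }
    where open Reaches reach

  reaches-≡ : ∀ {q q′ d} → q ≡ q′ → Reaches q d → Reaches q′ d
  reaches-≡ e = reaches-mod (≡⇒mod e)

  -- At an even position the number of blocks is dictated by the position and the run length absorbs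
  -- the remainder b, so the parity of u selects the shape. The state (0 , up) is an exception.
  reaches-even : ∀ u b → 1 ℕ.+ (2 ℕ.* u ℕ.+ 2 ℕ.* b) ≡ k → ∀ d → Reaches (+ 2 * + u) d
  reaches-even u b k≡ d with parity u
  reaches-even _ b k≡ down | even e =
    reaches-≡ (trans (((∀ e → + 4 * e ≡ + 2 * (+ 2 * e)) ∋ solve-∀) (+ e)) (cong (+ 2 *_) (sym (ℤ.pos-* 2 e))))
      (reaches-up-and-back b e (trans (((∀ b e → 1 ℕ.+ (2 ℕ.* b ℕ.+ 4 ℕ.* e) ≡ 1 ℕ.+ (2 ℕ.* (2 ℕ.* e) ℕ.+ 2 ℕ.* b)) ∋ ℕ-Solver.solve-∀) b e) k≡) 1<k)
  -- Two laps without blocks: the word is r^k, and its target 2b + 1 is k, the class of 0.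
  reaches-even _ b k≡ up | even zero =
    reaches-mod (by 1ℤ (trans +k≡ (sym (trans (ℤ.+-identityˡ (1ℤ * + k)) (ℤ.*-identityˡ (+ k))))))
      (reaches-two-laps b 0 k≡′)
    where
    k≡′ : 1 ℕ.+ (2 ℕ.* b ℕ.+ 0) ≡ k
    k≡′ = trans (cong suc (ℕ.+-identityʳ (2 ℕ.* b))) k≡
    +k≡ : + 2 * + b + 1ℤ ≡ + k
    +k≡ = trans (ℤ.+-comm (+ 2 * + b) 1ℤ) (trans (cong (λ j → 1ℤ + j) (sym (ℤ.pos-* 2 b))) (cong +_ k≡))
  reaches-even _ b k≡ up | even (suc e) =
    reaches-≡ (trans (((∀ e → + 4 * e + + 4 ≡ + 2 * (+ 2 * (1ℤ + e))) ∋ solve-∀) (+ e)) (cong (+ 2 *_) (sym (ℤ.pos-* 2 (suc e)))))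
      (reaches-descent′ b e (trans (((∀ b e → 3 ℕ.+ (2 ℕ.* suc b ℕ.+ 4 ℕ.* e) ≡ 1 ℕ.+ (2 ℕ.* (2 ℕ.* suc e) ℕ.+ 2 ℕ.* b)) ∋ ℕ-Solver.solve-∀) b e) k≡))
  reaches-even _ b k≡ down | odd e =
    reaches-≡ (trans (((∀ e → + 4 * e + + 2 ≡ + 2 * (1ℤ + + 2 * e)) ∋ solve-∀) (+ e)) (cong (λ j → + 2 * (1ℤ + j)) (sym (ℤ.pos-* 2 e))))
      (reaches-descent b e (trans (((∀ b e → 3 ℕ.+ (2 ℕ.* b ℕ.+ 4 ℕ.* e) ≡ 1 ℕ.+ (2 ℕ.* (1 ℕ.+ 2 ℕ.* e) ℕ.+ 2 ℕ.* b)) ∋ ℕ-Solver.solve-∀) b e) k≡))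
  reaches-even _ b k≡ up | odd e =
    reaches-≡ (trans (((∀ e → + 4 * e + + 2 ≡ + 2 * (1ℤ + + 2 * e)) ∋ solve-∀) (+ e)) (cong (λ j → + 2 * (1ℤ + j)) (sym (ℤ.pos-* 2 e))))
      (reaches-up-and-back′ b e (trans (((∀ b e → 1 ℕ.+ (2 ℕ.* suc b ℕ.+ 4 ℕ.* e) ≡ 1 ℕ.+ (2 ℕ.* (1 ℕ.+ 2 ℕ.* e) ℕ.+ 2 ℕ.* b)) ∋ ℕ-Solver.solve-∀) b e) k≡) 1<k)

  -- Here the position dictates the run length and the blocks absorb the remainder, so the parity of
  -- w selects the shape.
  reaches-odd : ∀ u w → 1 ℕ.+ (2 ℕ.* u ℕ.+ 2 ℕ.* suc w) ≡ k → ∀ d → Reaches (+ 2 * + u + 1ℤ) d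
  reaches-odd u w k≡ d with parity w
  reaches-odd u _ k≡ up | even i =
    reaches-back-and-beyond′ u i (trans (((∀ u i → 3 ℕ.+ (2 ℕ.* u ℕ.+ 4 ℕ.* i) ≡ 1 ℕ.+ (2 ℕ.* u ℕ.+ 2 ℕ.* suc (2 ℕ.* i))) ∋ ℕ-Solver.solve-∀) u i) k≡)
  reaches-odd u _ k≡ down | even i =
    reaches-two-laps′ u i (trans (((∀ u i → 1 ℕ.+ (2 ℕ.* suc u ℕ.+ 4 ℕ.* i) ≡ 1 ℕ.+ (2 ℕ.* u ℕ.+ 2 ℕ.* suc (2 ℕ.* i))) ∋ ℕ-Solver.solve-∀) u i) k≡)
  reaches-odd u _ k≡ up | odd i =
    reaches-two-laps u (suc i) (trans (((∀ u i → 1 ℕ.+ (2 ℕ.* u ℕ.+ 4 ℕ.* suc i) ≡ 1 ℕ.+ (2 ℕ.* u ℕ.+ 2 ℕ.* suc (1 ℕ.+ 2 ℕ.* i))) ∋ ℕ-Solver.solve-∀) u i) k≡)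
  reaches-odd u _ k≡ down | odd i =
    reaches-≡ (((∀ u → + 2 * (1ℤ + u) - 1ℤ ≡ + 2 * u + 1ℤ) ∋ solve-∀) (+ u))
      (reaches-back-and-beyond (suc u) i (trans (((∀ u i → 3 ℕ.+ (2 ℕ.* suc u ℕ.+ 4 ℕ.* i) ≡ 1 ℕ.+ (2 ℕ.* u ℕ.+ 2 ℕ.* suc (1 ℕ.+ 2 ℕ.* i))) ∋ ℕ-Solver.solve-∀) u i) k≡))

  reaches-< : ∀ h → 1 ℕ.+ 2 ℕ.* h ≡ k → ∀ j → j ℕ.< k → ∀ d → Reaches (+ j) d
  reaches-< h k≡ j j<k d with parity j
  ... | even u with ℕ.m≤n⇒∃[o]m+o≡n (ℕ.*-cancelˡ-≤ {u} {h} 2 (ℕ.s≤s⁻¹ (subst (2 ℕ.* u ℕ.<_) (sym k≡) j<k)))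
  ...   | b , refl = reaches-≡ (sym (ℤ.pos-* 2 u))
                       (reaches-even u b (trans (cong suc (sym (ℕ.*-distribˡ-+ 2 u b))) k≡) d)
  reaches-< h k≡ j j<k d | odd u
      with ℕ.m≤n⇒∃[o]m+o≡n (ℕ.*-cancelˡ-< 2 u h (ℕ.s<s⁻¹ (subst (1 ℕ.+ 2 ℕ.* u ℕ.<_) (sym k≡) j<k)))
  ...   | w , refl = reaches-≡ (trans (ℤ.+-comm (+ 2 * + u) 1ℤ) (cong (λ j → 1ℤ + j) (sym (ℤ.pos-* 2 u))))
                       (reaches-odd u w (trans
                         (((∀ u w → 1 ℕ.+ (2 ℕ.* u ℕ.+ 2 ℕ.* suc w) ≡ 1 ℕ.+ 2 ℕ.* (suc u ℕ.+ w)) ∋ ℕ-Solver.solve-∀) u w) k≡) d)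

  reaches : ∀ h → 1 ℕ.+ 2 ℕ.* h ≡ k → ∀ q d → Reaches q d
  reaches h k≡ q d = reaches-mod (mod-sym (%-mod q)) (reaches-< h k≡ (q %ℕ k) (n%ℕd<d q k) d)

-- Cayley digraphs of finite groups

-- Otherwise, sending each element to an index where it occurs in L would embed `Fin n` into fewer
-- than n indices.
∃∉ : ∀ {n} (L : List (Fin n)) → length L ℕ.< n → ∃ λ i → i ∉ L
∃∉ {n} L L<n with Fin.any? (λ i → ¬? (i ∈? L))
  where open DecMembership Fin._≟_ using (_∈?_)
... | yes missing = missing
... | no ¬missing = contradiction collision (λ (i , j , i<j , e) → Fin.<⇒≢ i<j (index-injective e))
  where
  open DecMembership (Fin._≟_ {n}) using (_∈?_)
  full : ∀ i → i ∈ L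
  full i = decidable-stable (i ∈? L) (λ i∉L → ¬missing (i , i∉L))
  collision = Fin.pigeonhole L<n (λ i → Any.index (full i))
  index-injective : ∀ {i j} → Any.index (full i) ≡ Any.index (full j) → i ≡ j
  index-injective {i} {j} e = trans (lookup-index (full i)) (trans (cong (lookup L) e) (sym (lookup-index (full j))))

length-concatMap : ∀ {A B : Set} {c} (f : A → List B) → (∀ x → length (f x) ≡ c) →
                   ∀ xs → length (concatMap f xs) ≡ length xs ℕ.* c
length-concatMap f eq []       = refl
length-concatMap f eq (x ∷ xs) =
  trans (List.length-++ (f x)) (cong₂ ℕ._+_ (eq x) (length-concatMap f eq xs))

geometric : ℕ → ℕ → ℕ
geometric d zero    = 0
geometric d (suc j) = d ℕ.^ j ℕ.+ geometric d j

geometric-sum : ∀ c j → c ℕ.* geometric (suc c) j ℕ.+ 1 ≡ suc c ℕ.^ j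
geometric-sum c zero    = cong (ℕ._+ 1) (ℕ.*-zeroʳ c)
geometric-sum c (suc j) = begin
  c ℕ.* (suc c ℕ.^ j ℕ.+ geometric (suc c) j) ℕ.+ 1
    ≡⟨ ((∀ c x g → c ℕ.* (x ℕ.+ g) ℕ.+ 1 ≡ c ℕ.* g ℕ.+ 1 ℕ.+ c ℕ.* x) ∋ ℕ-Solver.solve-∀) c (suc c ℕ.^ j) (geometric (suc c) j) ⟩
  c ℕ.* geometric (suc c) j ℕ.+ 1 ℕ.+ c ℕ.* suc c ℕ.^ j ≡⟨ cong (ℕ._+ c ℕ.* suc c ℕ.^ j) (geometric-sum c j) ⟩
  suc c ℕ.^ suc j ∎
  where open ≡-Reasoning

^-distribʳ-* : ∀ a b n → (a ℕ.* b) ℕ.^ n ≡ a ℕ.^ n ℕ.* b ℕ.^ n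
^-distribʳ-* a b zero    = refl
^-distribʳ-* a b (suc n) = trans (cong (a ℕ.* b ℕ.*_) (^-distribʳ-* a b n))
  (((∀ a b x y → a ℕ.* b ℕ.* (x ℕ.* y) ≡ a ℕ.* x ℕ.* (b ℕ.* y)) ∋ ℕ-Solver.solve-∀) a b (a ℕ.^ n) (b ℕ.^ n))

module _ {n : ℕ} (G : FinGroup n) where
  open FinGroup G
  open IsGroup isGroup using (assoc; identityʳ; identityˡ; inverseʳ)

  walkEnd-∙ : ∀ X u v w → walkEnd G X (u ∙ v) w ≡ u ∙ walkEnd G X v w
  walkEnd-∙ X u v []      = refl
  walkEnd-∙ X u v (x ∷ w) = trans (cong (λ y → walkEnd G X y w) (assoc u v x)) (walkEnd-∙ X u (v ∙ x) w)

  -- Left translation by u is an automorphism of the Cayley digraph, so a walk from ε to u⁻¹v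
  -- becomes one from u to v.
  reach-from-ε⇒reach : ∀ X {j} → (∀ v → WalkOfLength G X j ε v) → ∀ u v → DistLe G X j u v
  reach-from-ε⇒reach X {j} walk u v with walk ((u ⁻¹) ∙ v)
  ... | w , w⊆X , len , e = j , ℕ.≤-refl , w , w⊆X , len , (begin
    walkEnd G X u w       ≡⟨ cong (λ y → walkEnd G X y w) (identityʳ u) ⟨
    walkEnd G X (u ∙ ε) w ≡⟨ walkEnd-∙ X u ε w ⟩
    u ∙ walkEnd G X ε w   ≡⟨ cong (u ∙_) e ⟩
    u ∙ ((u ⁻¹) ∙ v)      ≡⟨ assoc u (u ⁻¹) v ⟨
    (u ∙ (u ⁻¹)) ∙ v      ≡⟨ cong (_∙ v) (inverseʳ u) ⟩
    ε ∙ v                 ≡⟨ identityˡ v ⟩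
    v                     ∎)
    where open ≡-Reasoning

  module _ (X : List (Fin n)) where

    -- Endpoints of all walks of length j, with repetitions, rather than a metric sphere; this makes
    -- its length an exact power.
    sphere : ℕ → Fin n → List (Fin n)
    sphere zero    u = u ∷ []
    sphere (suc j) u = concatMap (λ x → sphere j (u ∙ x)) X

    length-sphere : ∀ j u → length (sphere j u) ≡ length X ℕ.^ j
    length-sphere zero    u = refl
    length-sphere (suc j) u = length-concatMap (λ x → sphere j (u ∙ x)) (λ x → length-sphere j (u ∙ x)) X

    walkEnd∈sphere : ∀ u w → All (_∈ X) w → walkEnd G X u w ∈ sphere (length w) u
    walkEnd∈sphere u []      []           = here refl
    walkEnd∈sphere u (x ∷ w) (x∈X ∷ w⊆X) =
      ∈-concatMap⁺ (λ y → sphere (length w) (u ∙ y)) (lose x∈X (walkEnd∈sphere (u ∙ x) w w⊆X))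

    ball : ℕ → Fin n → List (Fin n)
    ball zero    u = []
    ball (suc j) u = sphere j u ++ ball j u

    length-ball : ∀ j u → length (ball j u) ≡ geometric (length X) j
    length-ball zero    u = refl
    length-ball (suc j) u = trans (List.length-++ (sphere j u)) (cong₂ ℕ._+_ (length-sphere j u) (length-ball j u))

    sphere⊆ball : ∀ {i j u v} → i ℕ.< j → v ∈ sphere i u → v ∈ ball j u
    sphere⊆ball {i} {suc j} {u} (s≤s i≤j) v∈ with ℕ.m≤n⇒m<n∨m≡n i≤j
    ... | inj₁ i<j  = ∈-++⁺ʳ (sphere j u) (sphere⊆ball i<j v∈)
    ... | inj₂ refl = ∈-++⁺ˡ v∈

    -- The directed Moore bound: the walks from ε shorter than k are too few to end at every vertex.
    far-vertex : ∀ k → geometric (length X) k ℕ.< n → ∃ λ u → ∃ λ v → ∀ j → j ℕ.< k → ¬ WalkOfLength G X j u v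
    far-vertex k small with ∃∉ (ball k ε) (subst (ℕ._< n) (sym (length-ball k ε)) small)
    ... | v , v∉ball = ε , v , λ where
      j j<k (w , w⊆X , refl , refl) → v∉ball (sphere⊆ball j<k (walkEnd∈sphere ε w w⊆X))

-- The Cayley digraph of the wreath product

module Generators (k m : ℕ) .{{_ : ℕ.NonZero k}} .{{_ : ℕ.NonZero m}} where
  open FiniteWreath k m public
  open Words k
  open Reaching k using (start; Reaches)
  open FinGroup G using (_∙_; ε)

  shift : Letter → State
  shift r = + 2 , up
  shift s = 0ℤ , down

  step-⊙ : ∀ g l → step g l ≡ g ⊙ shift l
  step-⊙ (q , up)   r = refl
  step-⊙ (q , up)   s = cong (_, down) (sym (ℤ.+-identityʳ q))
  step-⊙ (q , down) r = refl
  step-⊙ (q , down) s = cong (_, up) (sym (ℤ.+-identityʳ q))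

  pulse-cong : ∀ l {x y} → x ≡ y ⟨mod k ⟩ → pulse l x ≡ pulse l y
  pulse-cong r e = δ-cong e
  pulse-cong s e = cong₂ _+_ (δ-cong e) (δ-cong (mod-- e (≡⇒mod refl)))

  generator : Letter → Fin m → Element
  generator l h = element (λ x → ℤₘ.rep h * pulse l x) (shift l)
    (λ e → ≡⇒mod (cong (ℤₘ.rep h *_) (pulse-cong l e)))

  gen : Letter → Fin m → Fin (2 ℕ.* k ℕ.* m ℕ.^ k)
  gen l h = encode (generator l h)

  decode-injective : ∀ {i j} → decode i ≈ decode j → i ≡ j
  decode-injective {i} {j} e = trans (sym (encode-decode i)) (trans (encode-cong e) (encode-decode j))

  encode-injective : ∀ {a b} → encode a ≡ encode b → a ≈ b
  encode-injective {a} {b} e = ≈-trans (≈-sym (decode-encode a)) (subst (λ i → decode i ≈ b) (sym e) (decode-encode b))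
    where open Group wreath using () renaming (sym to ≈-sym; trans to ≈-trans)

  spell : (W : List Letter) → Vec ℤ (length W) → List (Fin (2 ℕ.* k ℕ.* m ℕ.^ k))
  spell []      []       = []
  spell (l ∷ W) (v ∷ vs) = gen l (ℤₘ.residue v) ∷ spell W vs

  length-spell : ∀ W vs → length (spell W vs) ≡ length W
  length-spell []      []       = refl
  length-spell (l ∷ W) (v ∷ vs) = cong suc (length-spell W vs)

  -- Right multiplication by a generator is one step of the machine. Stating it for any integer data
  -- f, g congruent to u lets steps be chained without reducing.
  step-≈ : ∀ u (g : State) (f : ℤ → ℤ) l v → (∀ x → fun (decode u) x ≡ f x ⟨mod m ⟩) → state (decode u) ≈ˢ g →
           (∀ x → fun (decode (u ∙ gen l (ℤₘ.residue v))) x ≡ f x + v * write g l x ⟨mod m ⟩)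
           × state (decode (u ∙ gen l (ℤₘ.residue v))) ≈ˢ step g l
  step-≈ u g f l v f≈ g≈ =
      (λ x → mod-trans (fun-≈ expand x) (mod-+ (f≈ x)
        (mod-trans (mod-*ʳ _ (ℤₘ.rep-residue v)) (≡⇒mod (cong (v *_) (pulse-cong l (act⁻¹-cong {state (decode u)} g≈ (≡⇒mod refl))))))))
    , ≈ˢ-trans {state (decode (u ∙ gen l (ℤₘ.residue v)))} {state (decode u) ⊙ shift l} {step g l} (state-≈ expand)
        (≈ˢ-trans {state (decode u) ⊙ shift l} {g ⊙ shift l} {step g l}
          (⊙-cong {state (decode u)} {g} {shift l} g≈ (≡⇒≈ˢ {shift l} refl)) (≡⇒≈ˢ (sym (step-⊙ g l))))
    where
    expand : decode (u ∙ gen l (ℤₘ.residue v)) ≈ decode u *ᵂ generator l (ℤₘ.residue v)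
    expand = Γ.trans (decode-encode _) (Γ.∙-congˡ {decode u} (decode-encode _))
      where module Γ = Group wreath

  walkEnd-spell : ∀ X u (g : State) (f : ℤ → ℤ) W vs → (∀ x → fun (decode u) x ≡ f x ⟨mod m ⟩) → state (decode u) ≈ˢ g →
    (∀ x → fun (decode (walkEnd G X u (spell W vs))) x ≡ f x + eval g W vs x ⟨mod m ⟩)
    × state (decode (walkEnd G X u (spell W vs))) ≈ˢ end g W
  walkEnd-spell X u g f []      []       f≈ g≈ = (λ x → mod-trans (f≈ x) (≡⇒mod (sym (ℤ.+-identityʳ (f x))))) , g≈
  walkEnd-spell X u g f (l ∷ W) (v ∷ vs) f≈ g≈ =
    let f≈′ , g≈′ = step-≈ u g f l v f≈ g≈
        f≈″ , g≈″ = walkEnd-spell X (u ∙ gen l (ℤₘ.residue v)) (step g l) _ W vs f≈′ g≈′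
    in (λ x → mod-trans (f≈″ x) (≡⇒mod (ℤ.+-assoc (f x) _ _))) , g≈″

  -- The dihedral part of v selects the word, and the function part of v selects the coefficients of
  -- its letters.
  reaches⇒walk : ∀ X → (∀ l h → gen l h ∈ X) → (∀ q d → Reaches q d) → ∀ v → WalkOfLength G X k ε v
  reaches⇒walk X gen∈X reaches v = spell word vs , ⊆X word vs , trans (length-spell word vs) length≡k ,
      decode-injective
        ( (λ x → mod-trans (proj₁ walk x) (mod-trans (≡⇒mod (ℤ.+-identityˡ _)) (vs-correct x)))
        , ≈ˢ-trans (proj₂ walk) (≈ˢ-trans (≡⇒≈ˢ end≡) (position≡q , refl)))
    where
    target = decode v
    open Reaches (reaches (proj₁ (state target)) (proj₂ (state target)))
    surjective = fills-all⇒surjective {start} {word} fills (fun target) (respect target)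
    vs = proj₁ surjective
    vs-correct = proj₂ surjective
    decode-ε : decode ε ≈ εᵂ
    decode-ε = decode-encode εᵂ
    walk = walkEnd-spell X ε start (λ _ → 0ℤ) word vs (fun-≈ decode-ε) (state-≈ decode-ε)
    ⊆X : ∀ W vs → All (_∈ X) (spell W vs)
    ⊆X []      []       = []
    ⊆X (l ∷ W) (v ∷ vs) = gen∈X l (ℤₘ.residue v) ∷ ⊆X W vs

  generators : List (Fin (2 ℕ.* k ℕ.* m ℕ.^ k))
  generators = map (gen r) (allFin m) ++ map (gen s) (allFin m)

  gen∈generators : ∀ l h → gen l h ∈ generators
  gen∈generators r h = ∈-++⁺ˡ (∈-map⁺ (gen r) (∈-allFin h))
  gen∈generators s h = ∈-++⁺ʳ (map (gen r) (allFin m)) (∈-map⁺ (gen s) (∈-allFin h))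

  ∈generators⇒gen : ∀ {i} → i ∈ generators → ∃ λ l → ∃ λ h → i ≡ gen l h
  ∈generators⇒gen i∈ with ∈-++⁻ (map (gen r) (allFin m)) i∈
  ... | inj₁ i∈r = let h , _ , e = ∈-map⁻ (gen r) i∈r in r , h , e
  ... | inj₂ i∈s = let h , _ , e = ∈-map⁻ (gen s) i∈s in s , h , e

  length-generators : length generators ≡ m ℕ.+ m
  length-generators = trans (List.length-++ (map (gen r) (allFin m)))
    (cong₂ ℕ._+_ (length-part r) (length-part s))
    where
    length-part : ∀ l → length (map (gen l) (allFin m)) ≡ m
    length-part l = trans (List.length-map (gen l) (allFin m)) (List.length-tabulate {n = m} (λ i → i))

  module _ (2<k : 2 ℕ.< k) where

    -- Lets `gen-injective` read h off at cell 0; the extra e₁ in the pulse of `s` vanishes there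
    -- because k > 1.
    pulse-0 : ∀ l → pulse l 0ℤ ≡ 1ℤ
    pulse-0 r = δ-hit (≡⇒mod refl)
    pulse-0 s = trans (cong₂ _+_ (δ-hit (≡⇒mod refl)) (trans (δ-neg 1ℤ) (δ-miss 1≢0))) refl
      where
      1≢0 : ¬ 1ℤ ≡ 0ℤ ⟨mod k ⟩
      1≢0 e = contradiction (+[<n]-injective (ℕ.<-trans (s≤s (s≤s z≤n)) 2<k) (ℕ.<-trans (s≤s z≤n) 2<k) e) λ ()

    gen-injective : ∀ l {h h′} → gen l h ≡ gen l h′ → h ≡ h′
    gen-injective l {h} {h′} e = ℤₘ.rep-injective
      (mod-trans (≡⇒mod (sym (at-0 h))) (mod-trans (fun-≈ (encode-injective e) 0ℤ) (≡⇒mod (at-0 h′))))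
      where
      at-0 : ∀ h → ℤₘ.rep h * pulse l 0ℤ ≡ ℤₘ.rep h
      at-0 h = trans (cong (ℤₘ.rep h *_) (pulse-0 l)) (ℤ.*-identityʳ (ℤₘ.rep h))

    gen-r≢gen-s : ∀ h h′ → gen r h ≢ gen s h′
    gen-r≢gen-s h h′ e with proj₂ (state-≈ (encode-injective e))
    ... | ()

    -- The dihedral part alone decides, so h = 0 is no exception: the shift 2 of `r` is nonzero
    -- modulo k as 2 < k, and `s` reverses direction.
    ε≢gen : ∀ l h → ε ≢ gen l h
    ε≢gen r h e = contradiction (+[<n]-injective (ℕ.<-trans (s≤s z≤n) 2<k) 2<k (proj₁ (state-≈ (encode-injective e)))) λ ()
    ε≢gen s h e with proj₂ (state-≈ (encode-injective e))
    ... | ()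

    generators-unique : Unique generators
    generators-unique = Unique.++⁺ (Unique.map⁺ (gen-injective r) (Unique.allFin⁺ m))
      (Unique.map⁺ (gen-injective s) (Unique.allFin⁺ m))
      (λ (i∈r , i∈s) → let h , _ , e = ∈-map⁻ (gen r) i∈r
                           h′ , _ , e′ = ∈-map⁻ (gen s) i∈s
                       in gen-r≢gen-s h h′ (trans (sym e) e′))

    ε∉generators : ε ∉ generators
    ε∉generators ε∈ = let l , h , e = ∈generators⇒gen ε∈ in ε≢gen l h e

  connectionSet : 2 ℕ.< k → ∀ d → d ℕ.< 2 ℕ.* k ℕ.* m ℕ.^ k → d ≡ m ℕ.+ m ⊎ d ≡ 1 ℕ.+ (m ℕ.+ m) →
    ∃ λ X → IsConnectionSetOfDegree G X d × (∀ l h → gen l h ∈ X)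
  connectionSet 2<k d d<n (inj₁ d≡) =
    generators , (generators-unique 2<k , ε∉generators 2<k , trans length-generators (sym d≡)) , gen∈generators
  connectionSet 2<k d d<n (inj₂ d≡) =
    -- `ε ∷ generators` has exactly 2m + 1 = d entries, so d < n leaves an element outside it.
    let y , y∉ = ∃∉ (ε ∷ generators) (subst (ℕ._< 2 ℕ.* k ℕ.* m ℕ.^ k) (trans d≡ (cong suc (sym length-generators))) d<n)
    in y ∷ generators ,
       ( ¬Any⇒All¬ generators (y∉ ∘ there) ∷ generators-unique 2<k
       , (λ where (here ε≡y)  → y∉ (here (sym ε≡y))
                  (there ε∈) → ε∉generators 2<k ε∈)
       , trans (cong suc length-generators) (sym d≡)) ,
       λ l h → there (gen∈generators l h)

-- Numerical estimates and the theorem.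

geometric-bound : ∀ k d m → d ℕ.≤ 3 ℕ.* m → 3 ℕ.^ k ℕ.+ 2 ℕ.* k ℕ.≤ 2 ℕ.* k ℕ.* d →
                  geometric d k ℕ.< 2 ℕ.* k ℕ.* m ℕ.^ k
geometric-bound k zero    m d≤3m bound = contradiction (ℕ.≤-trans (ℕ.m^n>0 3 k) (ℕ.m+n≤o⇒m≤o (3 ℕ.^ k) bound))
  (ℕ.≤⇒≯ (ℕ.≤-reflexive (ℕ.*-zeroʳ (2 ℕ.* k))))
-- With d = c + 1, compare after multiplying by c: the geometric sum turns into d^k - 1, and the
-- hypothesis becomes 3^k ≤ 2kc.
geometric-bound k (suc c) m d≤3m bound = ℕ.*-cancelˡ-< c _ _ (begin-strict
  c ℕ.* geometric (suc c) k         <⟨ ℕ.≤-reflexive (ℕ.+-comm 1 _) ⟩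
  c ℕ.* geometric (suc c) k ℕ.+ 1   ≡⟨ geometric-sum c k ⟩
  suc c ℕ.^ k                       ≤⟨ ℕ.^-monoˡ-≤ k d≤3m ⟩
  (3 ℕ.* m) ℕ.^ k                   ≡⟨ ^-distribʳ-* 3 m k ⟩
  3 ℕ.^ k ℕ.* m ℕ.^ k               ≤⟨ ℕ.*-monoˡ-≤ (m ℕ.^ k) 3^k≤2kc ⟩
  2 ℕ.* k ℕ.* c ℕ.* m ℕ.^ k         ≡⟨ ((∀ a c x → a ℕ.* c ℕ.* x ≡ c ℕ.* (a ℕ.* x)) ∋ ℕ-Solver.solve-∀) (2 ℕ.* k) c (m ℕ.^ k) ⟩
  c ℕ.* (2 ℕ.* k ℕ.* m ℕ.^ k)       ∎)
  where
  open ℕ.≤-Reasoning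
  3^k≤2kc : 3 ℕ.^ k ℕ.≤ 2 ℕ.* k ℕ.* c
  3^k≤2kc = ℕ.+-cancelʳ-≤ (2 ℕ.* k) (3 ℕ.^ k) (2 ℕ.* k ℕ.* c)
    (ℕ.≤-trans bound (ℕ.≤-reflexive (trans (ℕ.*-suc (2 ℕ.* k) c) (ℕ.+-comm (2 ℕ.* k) _))))

-- For k ≥ 2 the sum contains d^(k-1). This gives the bound d < n that the choice of an extra
-- generator requires.
d≤geometric : ∀ d {k} → 2 ℕ.≤ k → d ℕ.≤ geometric d k
d≤geometric zero        _                          = z≤n
d≤geometric d@(suc _) {suc (suc k)} (s≤s (s≤s _)) =
  ℕ.≤-trans (ℕ.m≤m*n d (d ℕ.^ k) {{ℕ.m^n≢0 d k}}) (ℕ.m≤m+n (d ℕ.* d ℕ.^ k) _)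

halves : ∀ d → d ≡ d ℕ./ 2 ℕ.+ d ℕ./ 2 ⊎ d ≡ 1 ℕ.+ (d ℕ./ 2 ℕ.+ d ℕ./ 2)
halves d with d ℕ.% 2 | ℕ.m%n<n d 2 | ℕ.m≡m%n+[m/n]*n d 2
... | 0           | _               | e = inj₁ (trans e (((∀ x → x ℕ.* 2 ≡ x ℕ.+ x) ∋ ℕ-Solver.solve-∀) (d ℕ./ 2)))
... | 1           | _               | e = inj₂ (trans e (cong suc (((∀ x → x ℕ.* 2 ≡ x ℕ.+ x) ∋ ℕ-Solver.solve-∀) (d ℕ./ 2))))
... | suc (suc _) | s≤s (s≤s ())    | _

mainTheorem9 : (k d : ℕ) → 3 ℕ.≤ k → Odd k → 3 ℕ.^ k ℕ.+ 2 ℕ.* k ℕ.≤ 2 ℕ.* k ℕ.* d →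
    CdkAtLeast d k (2 ℕ.* k ℕ.* (d ℕ./ 2) ℕ.^ k)
mainTheorem9 k d 3≤k (h , k≡) bound =
  let X , connection@(_ , _ , length≡d) , gen∈X = connectionSet 3≤k d (ℕ.≤-<-trans (d≤geometric d 2≤k) small) (halves d)
  in 2 ℕ.* k ℕ.* m ℕ.^ k , G , X , connection ,
     ( reach-from-ε⇒reach G X (reaches⇒walk X gen∈X (reaches h (trans (ℕ.+-comm 1 (2 ℕ.* h)) (sym k≡))))
     , far-vertex G X k (subst (λ l → geometric l k ℕ.< 2 ℕ.* k ℕ.* m ℕ.^ k) (sym length≡d) small)) ,
     ℕ.≤-refl
  where
  m : ℕ
  m = d ℕ./ 2
  2≤k : 2 ℕ.≤ k
  2≤k = ℕ.<⇒≤ 3≤k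
  m≢0 : m ≢ 0
  -- If m = 0 then d ≤ 1, and the hypothesis would give 3^k + 2k ≤ 2k.
  m≢0 m≡0 = ℕ.<⇒≱ (ℕ.m^n>0 3 k) (ℕ.+-cancelʳ-≤ (2 ℕ.* k) (3 ℕ.^ k) 0 (ℕ.≤-trans bound
    (ℕ.≤-trans (ℕ.*-monoʳ-≤ (2 ℕ.* k) d≤1) (ℕ.≤-reflexive (ℕ.*-identityʳ (2 ℕ.* k))))))
    where
    d≤1 : d ℕ.≤ 1
    d≤1 with halves d
    ... | inj₁ e = ℕ.≤-trans (ℕ.≤-reflexive (trans e (cong₂ ℕ._+_ m≡0 m≡0))) z≤n
    ... | inj₂ e = ℕ.≤-reflexive (trans e (cong₂ (λ a b → 1 ℕ.+ (a ℕ.+ b)) m≡0 m≡0))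
  instance
    k-nonZero : ℕ.NonZero k
    k-nonZero = ℕ.>-nonZero (ℕ.<-trans (s≤s z≤n) 2≤k)
    m-nonZero : ℕ.NonZero m
    m-nonZero = ℕ.≢-nonZero m≢0
  open Generators k m
  open AllStates k 2≤k using (reaches)
  d≤3m : d ℕ.≤ 3 ℕ.* m
  d≤3m with halves d
  ... | inj₁ e = ℕ.≤-trans (ℕ.≤-reflexive e) (ℕ.+-monoʳ-≤ m (ℕ.m≤m+n m _))
  -- For odd d the surplus 1 in d = 2m + 1 is at most m.
  ... | inj₂ e = ℕ.≤-trans (ℕ.≤-reflexive e) (ℕ.≤-trans (ℕ.+-monoˡ-≤ (m ℕ.+ m) (ℕ.n≢0⇒n>0 m≢0))
    (ℕ.≤-reflexive (((∀ x → x ℕ.+ (x ℕ.+ x) ≡ 3 ℕ.* x) ∋ ℕ-Solver.solve-∀) m)))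
  small : geometric d k ℕ.< 2 ℕ.* k ℕ.* m ℕ.^ k
  small = geometric-bound k d m d≤3m bound
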